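{- For primes $p\equiv 3\pmod 4$, the mixing time $\tau_p$ of the random walk on circles defined below satisfies $\tau_p=O(p)$ as $p\to\infty$.
   Context: For $K\in\mathbb{F}_p$ let $C_K=\{(u,v)\in\mathbb{F}_p^2:u^2+v^2=K\}$, and for $i,j,k\in\mathbb{F}_p$ let $N_{ij}^k=\#\{(a,b)\in C_i\times C_j: a+b\in C_k\}$ and $n_{ij}^k=N_{ij}^k/(|C_i||C_j|)$. Consider the Markov chain on the $p$ states $c_0,\dots,c_{p-1}$ with kernel $A_1(c_i,c_j)=n_{i1}^j$ (the quadrance of a walk taking uniform steps from $C_1$). Its stationary distribution is $\pi(c_0)=1/p^2$, $\pi(c_j)=(p+1)/p^2$ for $j\ne0$. The total variation distance is $d_{TV}(\mu,\nu)=\frac12\sum_x|\mu(x)-\nu(x)|$, and $\tau_p=\max_{i}\min\{t: d_{TV}(A_1^t(c_i,\cdot),\pi)\le 1/(2e)\}$. -}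

module Defs where

open import Data.Bool using (Bool; true; false; _∧_; if_then_else_)
open import Data.Nat as ℕ using (ℕ; zero; suc; NonZero; _%_; _≡ᵇ_; _!)
open import Data.Fin as Fin using (Fin; toℕ)
open import Data.Integer using (+_)
open import Data.List using (List; allFin; foldr; length; filterᵇ; cartesianProduct)
open import Data.Product using (_×_; _,_)
open import Data.Rational using (ℚ; _/_; 0ℚ; 1ℚ; ½; ∣_∣; _≤_)
  renaming (_+_ to _+q_; _*_ to _*q_; _-_ to _-q_)
open import Relation.Nullary using (does)

-- Points of F_p^2, coordinates represented by Fin p
Pt : ℕ → Set
Pt p = Fin p × Fin p

pts : (p : ℕ) → List (Pt p)
pts p = cartesianProduct (allFin p) (allFin p)

quadN : (p : ℕ) → .{{NonZero p}} → ℕ → ℕ → ℕ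
quadN p x y = (x ℕ.* x ℕ.+ y ℕ.* y) % p

-- membership of a point in the circle C_K (K given by its representative in {0..p-1})
inC : (p : ℕ) → .{{NonZero p}} → ℕ → Pt p → Bool
inC p K (u , v) = quadN p (toℕ u) (toℕ v) ≡ᵇ K

count : {A : Set} → (A → Bool) → List A → ℕ
count f xs = length (filterᵇ f xs)

cardC : (p : ℕ) → .{{NonZero p}} → ℕ → ℕ
cardC p K = count (inC p K) (pts p)

Ncount : (p : ℕ) → .{{NonZero p}} → ℕ → ℕ → ℕ → ℕ
Ncount p i j k = count f (cartesianProduct (pts p) (pts p))
  where
  f : Pt p × Pt p → Bool
  f ((u₁ , v₁) , (u₂ , v₂)) =
    inC p i (u₁ , v₁) ∧ inC p j (u₂ , v₂)
      ∧ (quadN p (toℕ u₁ ℕ.+ toℕ u₂) (toℕ v₁ ℕ.+ toℕ v₂) ≡ᵇ k)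

-- rational quotient of naturals; convention n / 0 = 0 (never used for prime p)
divq : ℕ → ℕ → ℚ
divq n zero = 0ℚ
divq n (suc d) = (+ n) / suc d

A₁ : (p : ℕ) → .{{NonZero p}} → Fin p → Fin p → ℚ
A₁ p i j = divq (Ncount p (toℕ i) 1 (toℕ j)) (cardC p (toℕ i) ℕ.* cardC p 1)

sumFin : (p : ℕ) → (Fin p → ℚ) → ℚ
sumFin p f = foldr (λ x acc → f x +q acc) 0ℚ (allFin p)

Dist : ℕ → Set
Dist p = Fin p → ℚ

δ : (p : ℕ) → Fin p → Dist p
δ p i j = if does (i Fin.≟ j) then 1ℚ else 0ℚ

step : (p : ℕ) → .{{NonZero p}} → Dist p → Dist p
step p μ j = sumFin p (λ i → μ i *q A₁ p i j)

row : (p : ℕ) → .{{NonZero p}} → ℕ → Fin p → Dist p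
row p zero i = δ p i
row p (suc t) i = step p (row p t i)

-- stationary distribution π
π : (p : ℕ) → Dist p
π p j with toℕ j
... | zero = divq 1 (p ℕ.* p)
... | suc _ = divq (suc p) (p ℕ.* p)

dTV : (p : ℕ) → Dist p → Dist p → ℚ
dTV p μ ν = ½ *q sumFin p (λ x → ∣ μ x -q ν x ∣)

eSum : ℕ → ℚ
eSum zero = 1ℚ
eSum (suc n) = eSum n +q divq 1 (suc n !)

-- d ≤ 1/(2e), i.e. 2 d e ≤ 1, i.e. 2 d S_n ≤ 1 for all n (S_n ↑ e, d ≥ 0)
≤1/2e : ℚ → Set
≤1/2e d = ∀ n → (+ 2 / 1) *q d *q eSum n ≤ 1ℚ

mixedAt : (p : ℕ) → .{{NonZero p}} → ℕ → Fin p → Set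
mixedAt p t i = ≤1/2e (dTV p (row p t i) (π p))

{-# OPTIONS --safe #-}
module Submission where

-- Dually to total variation, follow a function g on the states with values in an interval [a, b] and let
-- A g denote its averages over the rows of the kernel. If two rows share a state of mass at least ε, the
-- corresponding averages differ by at most (1 − ε)(b − a).
--
-- For p ≡ 3 (mod 4) one has |C₀| = 1 and |C_j| = p + 1 for j ≠ 0. For i ≠ 0 the map a ↦ Q(a + (1, 0)) on C_i
-- has fibres of size at most 2. For i, j ≠ 0 the circles C_i and C_j have 2(p + 1) > 2p points together, so
-- some fibre over a value k meets both; rotating by C₁ shows that both rows give k mass at least 1/(p + 1).
-- State 0 receives mass at most 1/2 from every state, so two steps shrink the interval by the factor
-- 1 − 1/(2(p + 1)), and O(p) steps suffice.

-- State 0 is the obstacle. Its circle is a single point, so the walk leaves it for state 1 with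
-- certainty, and this row may share no mass with the row of another state. One step therefore need
-- not shrink the interval: the first of the two steps only brings the values at nonzero states
-- together, and the second dilutes the value at 0, which enters every average with weight at most
-- ½.
--
-- The residue of p modulo 4 acts through one fact, that -1 is not a square, so that u² + v²
-- vanishes only at the origin. It makes C₀ a point, keeps 1 + t² invertible in the parametrisation
-- of circles, and bounds the mass that state 0 receives.
--
-- No logarithm of p appears because total variation is tested against functions with values ±1: the
-- interval starts with width 2 and has to reach a width independent of p, namely 1/3, which
-- suffices because e ≤ 3.

open import Defs
open import Data.Bool using (Bool; true; false; _∧_; not; T; T?)
open import Data.Bool.Properties using (T-∧; ∧-assoc; ∧-comm)
open import Data.Empty using (⊥; ⊥-elim)
open import Data.Fin as Fin using (Fin; toℕ; fromℕ<)
open import Data.Fin.Properties using (toℕ<n; toℕ-injective; toℕ-fromℕ<)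
open import Data.Integer as ℤ using (ℤ; 0ℤ; 1ℤ; _%ℕ_; _/ℕ_)
import Data.Integer.Properties as ℤ
open import Data.Integer.DivMod using (n%ℕd<d; a≡a%ℕn+[a/ℕn]*n)
open import Data.Integer.Divisibility.Signed using (_∣_; divides; ∣⇒∣ᵤ; ∣ᵤ⇒∣; ∣m∣n⇒∣m+n; ∣n⇒∣m*n; _∣?_)
import Data.Integer.Tactic.RingSolver as ℤ-solver
open import Data.List using (List; []; _∷_; _++_; allFin; foldr; length; filterᵇ; cartesianProduct; map)
open import Data.List.Membership.Propositional using (_∈_)
open import Data.List.Membership.Propositional.Properties using (∈-∃++; ∈-++⁻; ∈-++⁺ˡ; ∈-++⁺ʳ; ∈-filter⁺; ∈-filter⁻; ∈-allFin; ∈-cartesianProduct⁺)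
open import Data.List.Properties using (length-++; length-tabulate; map-tabulate)
open import Data.List.Relation.Unary.All as All using ([]; _∷_)
open import Data.List.Relation.Unary.AllPairs using ([]; _∷_)
open import Data.List.Relation.Unary.Any using (here; there)
open import Data.List.Relation.Unary.Unique.Propositional using (Unique)
open import Data.List.Relation.Unary.Unique.Propositional.Properties using (filter⁺; allFin⁺; cartesianProduct⁺)
open import Data.Nat as ℕ using (ℕ; zero; suc; NonZero; _%_; _≡ᵇ_; _<ᵇ_; _!)
import Data.Nat.Properties as ℕ
import Data.Nat.Divisibility as ℕᵈ
open import Data.Nat.Coprimality using (coprime-Bézout; prime⇒coprime)
open import Data.Nat.DivMod using (m%n<n; [m+kn]%n≡m%n)
open import Data.Nat.GCD using (module Bézout)
open import Data.Nat.Primality using (Prime; euclidsLemma; prime⇒nonTrivial)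
import Data.Nat.Tactic.RingSolver as ℕ-solver
open import Data.Product using (∃-syntax; _×_; _,_; proj₁; proj₂)
open import Data.Rational as ℚ using (ℚ; 0ℚ; 1ℚ; ½; toℚᵘ)
import Data.Rational.Properties as ℚ
open import Data.Rational.Unnormalised as ℚᵘ using (mkℚᵘ; *≡*)
import Data.Rational.Unnormalised.Properties as ℚᵘ
open import Data.Sum using (_⊎_; inj₁; inj₂)
open import Data.Unit using (tt)
open import Function using (_∘_; Equivalence)
open import Level using (0ℓ)
open import Relation.Binary.PropositionalEquality using (_≡_; _≢_; refl; sym; trans; cong; cong₂; subst; subst₂; module ≡-Reasoning)
open import Relation.Nullary using (¬_; Dec; yes; no)
open import Relation.Nullary.Decidable using (dec⇒maybe)
import Tactic.RingSolver as RingSolver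
open import Tactic.RingSolver.Core.AlmostCommutativeRing using (AlmostCommutativeRing; fromCommutativeRing)

-- Counting in finite lists: injections, fibres, tight sums.

module Counting where
  open import Data.Nat using (_+_; _*_; _≤_; _<_; z≤n; s≤s)
  open import Data.Nat.Properties
  open import Data.Nat.Tactic.RingSolver using (solve-∀)

  private variable
    A B : Set

  T-∧-intro : ∀ {a b} → T a → T b → T (a ∧ b)
  T-∧-intro ta tb = Equivalence.from T-∧ (ta , tb)

  T-∧-elim : ∀ {a b} → T (a ∧ b) → T a × T b
  T-∧-elim = Equivalence.to T-∧

  indicator : Bool → ℕ
  indicator true  = 1
  indicator false = 0

  count-∷ : (P : A → Bool) (x : A) (xs : List A) → count P (x ∷ xs) ≡ indicator (P x) + count P xs
  count-∷ P x xs with P x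
  ... | true  = refl
  ... | false = refl

  count-cong : {P Q : A → Bool} → (∀ x → P x ≡ Q x) → ∀ xs → count P xs ≡ count Q xs
  count-cong eq [] = refl
  count-cong {P = P} {Q} eq (x ∷ xs) rewrite count-∷ P x xs | count-∷ Q x xs | eq x = cong (indicator (Q x) +_) (count-cong eq xs)

  count-all : (xs : List A) → count (λ _ → true) xs ≡ length xs
  count-all [] = refl
  count-all (x ∷ xs) = cong suc (count-all xs)

  count-split : (P Q : A → Bool) (xs : List A) →
    count P xs ≡ count (λ x → P x ∧ Q x) xs + count (λ x → P x ∧ not (Q x)) xs
  count-split P Q [] = refl
  count-split P Q (x ∷ xs)
    rewrite count-∷ P x xs | count-∷ (λ y → P y ∧ Q y) x xs | count-∷ (λ y → P y ∧ not (Q y)) x xs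
          | count-split P Q xs
    with P x | Q x
  ... | true  | true  = refl
  ... | true  | false = sym (+-suc _ _)
  ... | false | _     = refl

  count-witness : (P : A → Bool) (xs : List A) → 0 < count P xs → ∃[ x ] T (P x)
  count-witness P (x ∷ xs) pos with P x in eq
  ... | true  = x , subst T (sym eq) tt
  ... | false = count-witness P xs pos

  count-++ : (P : A → Bool) (xs ys : List A) → count P (xs ++ ys) ≡ count P xs + count P ys
  count-++ P [] ys = refl
  count-++ P (x ∷ xs) ys rewrite count-∷ P x (xs ++ ys) | count-∷ P x xs | count-++ P xs ys =
    sym (+-assoc (indicator (P x)) _ _)

  count-map : (P : B → Bool) (f : A → B) (xs : List A) → count P (map f xs) ≡ count (P ∘ f) xs
  count-map P f [] = refl
  count-map P f (x ∷ xs) rewrite count-∷ P (f x) (map f xs) | count-∷ (P ∘ f) x xs =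
    cong (indicator (P (f x)) +_) (count-map P f xs)

  count-none : (xs : List A) → count (λ _ → false) xs ≡ 0
  count-none [] = refl
  count-none (x ∷ xs) = count-none xs

  count-cartesianProduct : (P : A → Bool) (Q : B → Bool) (xs : List A) (ys : List B) →
    count (λ z → P (proj₁ z) ∧ Q (proj₂ z)) (cartesianProduct xs ys) ≡ count P xs * count Q ys
  count-cartesianProduct P Q [] ys = refl
  count-cartesianProduct P Q (x ∷ xs) ys = begin
    count PQ (map (x ,_) ys ++ cartesianProduct xs ys)
      ≡⟨ count-++ PQ (map (x ,_) ys) (cartesianProduct xs ys) ⟩
    count PQ (map (x ,_) ys) + count PQ (cartesianProduct xs ys)
      ≡⟨ cong₂ _+_ (trans (count-map PQ (x ,_) ys) (slice (P x))) (count-cartesianProduct P Q xs ys) ⟩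
    indicator (P x) * count Q ys + count P xs * count Q ys
      ≡⟨ *-distribʳ-+ (count Q ys) (indicator (P x)) (count P xs) ⟨
    (indicator (P x) + count P xs) * count Q ys
      ≡⟨ cong (_* count Q ys) (count-∷ P x xs) ⟨
    count P (x ∷ xs) * count Q ys ∎
    where
    open ≡-Reasoning
    PQ = λ z → P (proj₁ z) ∧ Q (proj₂ z)
    slice : ∀ b → count (λ y → b ∧ Q y) ys ≡ indicator b * count Q ys
    slice true  = sym (+-identityʳ _)
    slice false = count-none ys

  -- Delete the image of the head from `ys`. By injectivity no later element of `xs` has that image,
  -- so the images of the tail survive the deletion.
  length-≤-inj : (φ : A → B) {xs : List A} {ys : List B} → Unique xs →
    (∀ {x} → x ∈ xs → φ x ∈ ys) →
    (∀ {x y} → x ∈ xs → y ∈ xs → φ x ≡ φ y → x ≡ y) → length xs ≤ length ys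
  length-≤-inj φ [] into inj = z≤n
  length-≤-inj φ {x ∷ xs} (x∉ ∷ uniq) into inj with ∈-∃++ (into (here refl))
  ... | l , r , refl = begin
    suc (length xs)              ≤⟨ s≤s (length-≤-inj φ uniq into′ (λ p q → inj (there p) (there q))) ⟩
    suc (length (l ++ r))        ≡⟨ cong suc (length-++ l) ⟩
    suc (length l + length r)    ≡⟨ +-suc (length l) (length r) ⟨
    length l + suc (length r)    ≡⟨ length-++ l ⟨
    length (l ++ φ x ∷ r)        ∎
    where
    open ≤-Reasoning
    into′ : ∀ {y} → y ∈ xs → φ y ∈ l ++ r
    into′ y∈ with ∈-++⁻ l (into (there y∈))
    ... | inj₁ m = ∈-++⁺ˡ m
    ... | inj₂ (there m) = ∈-++⁺ʳ l m
    ... | inj₂ (here eq) = ⊥-elim (All.lookup x∉ y∈ (sym (inj (there y∈) (here refl) eq)))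

  count-≤-inj : (P : A → Bool) (Q : B → Bool) (φ : A → B) {xs : List A} {ys : List B} →
    Unique xs → (∀ y → y ∈ ys) → (∀ x → T (P x) → T (Q (φ x))) →
    (∀ x y → T (P x) → T (P y) → φ x ≡ φ y → x ≡ y) → count P xs ≤ count Q ys
  count-≤-inj P Q φ {xs} uniq full into inj = length-≤-inj φ (filter⁺ (T? ∘ P) uniq)
    (λ x∈ → ∈-filter⁺ (T? ∘ Q) (full _) (into _ (holds x∈)))
    (λ x∈ y∈ → inj _ _ (holds x∈) (holds y∈))
    where
    holds : ∀ {x} → x ∈ filterᵇ P xs → T (P x)
    holds x∈ = proj₂ (∈-filter⁻ (T? ∘ P) {xs = xs} x∈)

  sumℕ : List A → (A → ℕ) → ℕ
  sumℕ xs f = foldr (λ x acc → f x + acc) 0 xs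

  sumℕ-cong : (xs : List A) {f g : A → ℕ} → (∀ x → f x ≡ g x) → sumℕ xs f ≡ sumℕ xs g
  sumℕ-cong [] eq = refl
  sumℕ-cong (x ∷ xs) eq = cong₂ _+_ (eq x) (sumℕ-cong xs eq)

  sumℕ-const : (xs : List A) (c : ℕ) → sumℕ xs (λ _ → c) ≡ length xs * c
  sumℕ-const [] c = refl
  sumℕ-const (x ∷ xs) c = cong (c +_) (sumℕ-const xs c)

  sumℕ-+ : (xs : List A) (f g : A → ℕ) → sumℕ xs (λ x → f x + g x) ≡ sumℕ xs f + sumℕ xs g
  sumℕ-+ [] f g = refl
  sumℕ-+ (x ∷ xs) f g rewrite sumℕ-+ xs f g = interchange (f x) (g x) (sumℕ xs f) (sumℕ xs g)
    where
    interchange : ∀ a b c d → a + b + (c + d) ≡ a + c + (b + d)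
    interchange = solve-∀

  sumℕ-≤ : (xs : List A) (f : A → ℕ) (c : ℕ) → (∀ x → f x ≤ c) → sumℕ xs f ≤ length xs * c
  sumℕ-≤ [] f c le = z≤n
  sumℕ-≤ (x ∷ xs) f c le = +-mono-≤ (le x) (sumℕ-≤ xs f c le)

  sumℕ-pigeonhole : (xs : List A) (f : A → ℕ) (c : ℕ) → length xs * c < sumℕ xs f → ∃[ x ] c < f x
  sumℕ-pigeonhole (x ∷ xs) f c lt with c <? f x
  ... | yes c<fx = x , c<fx
  ... | no  c≮fx = sumℕ-pigeonhole xs f c (+-cancelˡ-< c _ _ (<-≤-trans lt (+-monoˡ-≤ _ (≮⇒≥ c≮fx))))

  -- A term below `c` would leave a deficit that the other terms, bounded by `c`, cannot make up.
  sumℕ-tight : (xs : List A) (f : A → ℕ) (c : ℕ) → (∀ x → f x ≤ c) → sumℕ xs f ≡ length xs * c →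
    ∀ {x} → x ∈ xs → f x ≡ c
  sumℕ-tight (y ∷ xs) f c le eq x∈ = go x∈
    where
    rest≤ : sumℕ xs f ≤ length xs * c
    rest≤ = sumℕ-≤ xs f c le
    head≡ : f y ≡ c
    head≡ = ≤-antisym (le y) (+-cancelʳ-≤ (sumℕ xs f) c (f y)
      (≤-trans (+-monoʳ-≤ c rest≤) (≤-reflexive (sym eq))))
    go : ∀ {x} → x ∈ y ∷ xs → f x ≡ c
    go (here refl) = head≡
    go (there m)   = sumℕ-tight xs f c le
      (+-cancelˡ-≡ c _ _ (trans (cong (_+ sumℕ xs f) (sym head≡)) eq)) m

  sumℕ-map : (f : A → B) (g : B → ℕ) (xs : List A) → sumℕ (map f xs) g ≡ sumℕ xs (g ∘ f)
  sumℕ-map f g [] = refl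
  sumℕ-map f g (x ∷ xs) = cong (g (f x) +_) (sumℕ-map f g xs)

  allFin-suc : ∀ n → allFin (suc n) ≡ Fin.zero ∷ map Fin.suc (allFin n)
  allFin-suc n = cong (Fin.zero ∷_) (sym (map-tabulate (λ i → i) Fin.suc))

  sumℕ-allFin-suc : ∀ n (f : Fin (suc n) → ℕ) →
    sumℕ (allFin (suc n)) f ≡ f Fin.zero + sumℕ (allFin n) (f ∘ Fin.suc)
  sumℕ-allFin-suc n f =
    trans (cong (λ l → sumℕ l f) (allFin-suc n)) (cong (f Fin.zero +_) (sumℕ-map Fin.suc f (allFin n)))

  sumℕ-zero : (xs : List A) → sumℕ xs (λ _ → 0) ≡ 0
  sumℕ-zero xs = trans (sumℕ-const xs 0) (*-zeroʳ (length xs))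

  sumℕ-indicator : ∀ n m b → m < n → sumℕ (allFin n) (λ k → indicator (b ∧ (m ≡ᵇ toℕ k))) ≡ indicator b
  sumℕ-indicator n m false _ = sumℕ-zero (allFin n)
  sumℕ-indicator (suc n) zero true _ =
    trans (sumℕ-allFin-suc n (λ k → indicator (0 ≡ᵇ toℕ k))) (cong suc (sumℕ-zero (allFin n)))
  sumℕ-indicator (suc n) (suc m) true (s≤s m<n) =
    trans (sumℕ-allFin-suc n (λ k → indicator (suc m ≡ᵇ toℕ k))) (sumℕ-indicator n m true m<n)

  -- Each `x` is counted for exactly one `k`, namely `φ x`. All totals below are instances: points
  -- by quadrance, pairs by the quadrance of their sum or of their first point.
  sumℕ-fibres : ∀ n (P : A → Bool) (φ : A → ℕ) → (∀ x → φ x < n) → (xs : List A) →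
    sumℕ (allFin n) (λ k → count (λ x → P x ∧ (φ x ≡ᵇ toℕ k)) xs) ≡ count P xs
  sumℕ-fibres n P φ φ<n [] = sumℕ-zero (allFin n)
  sumℕ-fibres n P φ φ<n (x ∷ xs) = begin
    sumℕ (allFin n) (λ k → count (λ x → P x ∧ (φ x ≡ᵇ toℕ k)) (x ∷ xs))
      ≡⟨ sumℕ-cong (allFin n) (λ k → count-∷ (λ x → P x ∧ (φ x ≡ᵇ toℕ k)) x xs) ⟩
    sumℕ (allFin n) (λ k → indicator (P x ∧ (φ x ≡ᵇ toℕ k)) + count (λ x → P x ∧ (φ x ≡ᵇ toℕ k)) xs)
      ≡⟨ sumℕ-+ (allFin n) _ _ ⟩
    sumℕ (allFin n) (λ k → indicator (P x ∧ (φ x ≡ᵇ toℕ k))) + sumℕ (allFin n) (λ k → count (λ x → P x ∧ (φ x ≡ᵇ toℕ k)) xs)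
      ≡⟨ cong₂ _+_ (sumℕ-indicator n (φ x) (P x) (φ<n x)) (sumℕ-fibres n P φ φ<n xs) ⟩
    indicator (P x) + count P xs ≡⟨ count-∷ P x xs ⟨
    count P (x ∷ xs) ∎
    where open ≡-Reasoning

  length-allFin : ∀ n → length (allFin n) ≡ n
  length-allFin n = length-tabulate {n = n} (λ i → i)

  count-unique : {A : Set} (P : A → Bool) {xs : List A} → Unique xs → (∀ x → x ∈ xs) →
    (a : A) → T (P a) → (∀ x → T (P x) → x ≡ a) → count P xs ≡ 1
  count-unique P {xs} uniq full a Pa only = ≤-antisym
    (count-≤-inj P (λ _ → true) (λ _ → tt) {ys = tt ∷ []} uniq (λ _ → here refl) (λ _ _ → tt)
      (λ x y Px Py _ → trans (only x Px) (sym (only y Py))))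
    (count-≤-inj (λ _ → true) P (λ _ → a) {xs = tt ∷ []} ([] ∷ []) full (λ _ _ → Pa) (λ _ _ _ _ _ → refl))

  -- The identity n² = 1 + (n - 1)(n + 1) says that the upper bounds already add up to the total, so
  -- each of them is attained.
  sumℕ-tight-off-zero : ∀ n (f : Fin n → ℕ) → (∀ j → toℕ j ≡ 0 → f j ≡ 1) →
    (∀ j → toℕ j ≢ 0 → f j ≤ suc n) → sumℕ (allFin n) f ≡ n * n → ∀ j → toℕ j ≢ 0 → f j ≡ suc n
  sumℕ-tight-off-zero (suc n) f f0 f≤ total Fin.zero j≢0 = ⊥-elim (j≢0 refl)
  sumℕ-tight-off-zero (suc n) f f0 f≤ total (Fin.suc j) _ =
    sumℕ-tight (allFin n) (f ∘ Fin.suc) (2 + n) (λ k → f≤ (Fin.suc k) λ ()) rest (∈-allFin j)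
    where
    square : ∀ n → (1 + n) * (1 + n) ≡ 1 + n * (2 + n)
    square = solve-∀
    rest : sumℕ (allFin n) (f ∘ Fin.suc) ≡ length (allFin n) * (2 + n)
    rest = trans (+-cancelˡ-≡ 1 _ _ (begin
      1 + sumℕ (allFin n) (f ∘ Fin.suc)           ≡⟨ cong (_+ sumℕ (allFin n) (f ∘ Fin.suc)) (f0 Fin.zero refl) ⟨
      f Fin.zero + sumℕ (allFin n) (f ∘ Fin.suc)  ≡⟨ sumℕ-allFin-suc n f ⟨
      sumℕ (allFin (suc n)) f                       ≡⟨ total ⟩
      suc n * suc n                               ≡⟨ square n ⟩
      1 + n * (2 + n)                         ∎))
      (cong (_* (2 + n)) (sym (length-allFin n)))
      where open ≡-Reasoning

  T-not-elim : ∀ {b} → T (not b) → ¬ T b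
  T-not-elim {true} ()
  T-not-elim {false} _ ()

  T-not-intro : ∀ {b} → ¬ T b → T (not b)
  T-not-intro {true}  ¬t = ¬t tt
  T-not-intro {false} _  = tt

  T-not-not : ∀ {b} → T b → T (not (not b))
  T-not-not {true} _ = tt

open Counting

-- The field of residues modulo p, as integers up to congruence.

module Modular (p : ℕ) .{{nz : NonZero p}} where
  open import Data.Nat using (_≤_; _<_)
  open import Data.Integer using (+_; _+_; _-_; _*_; -_)
  open import Data.Integer.Tactic.RingSolver using (solve-∀)

  infix 4 _≈_ _≉_
  -- A record, so that `a` and `b` can be inferred from a congruence; the bare divisibility of
  -- `a - b` would not determine them for unification.
  record _≈_ (a b : ℤ) : Set where
    constructor ≈-mk
    field p∣a-b : + p ∣ a - b

  _≉_ : ℤ → ℤ → Set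
  a ≉ b = ¬ (a ≈ b)

  -- Congruences are derived by ideal membership: the difference of the two sides is written as an
  -- explicit combination of known differences, and the ring solver checks that identity over the
  -- integers.
  combination₁ : ∀ {x x′ y y′} c → y ≈ y′ → x - x′ ≡ c * (y - y′) → x ≈ x′
  combination₁ c (≈-mk d) eq = ≈-mk (subst (+ p ∣_) (sym eq) (∣n⇒∣m*n c d))

  combination₂ : ∀ {x x′ y y′ z z′} c d → y ≈ y′ → z ≈ z′ →
    x - x′ ≡ c * (y - y′) + d * (z - z′) → x ≈ x′
  combination₂ c d (≈-mk e) (≈-mk f) eq =
    ≈-mk (subst (+ p ∣_) (sym eq) (∣m∣n⇒∣m+n (∣n⇒∣m*n c e) (∣n⇒∣m*n d f)))

  combination₃ : ∀ {x x′ y y′ z z′ w w′} c d e → y ≈ y′ → z ≈ z′ → w ≈ w′ →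
    x - x′ ≡ c * (y - y′) + d * (z - z′) + e * (w - w′) → x ≈ x′
  combination₃ c d e (≈-mk f) (≈-mk g) (≈-mk h) eq = ≈-mk (subst (+ p ∣_) (sym eq)
    (∣m∣n⇒∣m+n (∣m∣n⇒∣m+n (∣n⇒∣m*n c f) (∣n⇒∣m*n d g)) (∣n⇒∣m*n e h)))

  ≈-reflexive : ∀ {a b} → a ≡ b → a ≈ b
  ≈-reflexive {a} refl = ≈-mk (divides 0ℤ (ℤ.+-inverseʳ a))

  ≈-refl : ∀ {a} → a ≈ a
  ≈-refl = ≈-reflexive refl

  ≈-sym : ∀ {a b} → a ≈ b → b ≈ a
  ≈-sym {a} {b} d = combination₁ (- 1ℤ) d (lemma a b)
    where
    lemma : ∀ a b → b - a ≡ - 1ℤ * (a - b)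
    lemma = solve-∀

  ≈-trans : ∀ {a b c} → a ≈ b → b ≈ c → a ≈ c
  ≈-trans {a} {b} {c} d e = combination₂ 1ℤ 1ℤ d e (lemma a b c)
    where
    lemma : ∀ a b c → a - c ≡ 1ℤ * (a - b) + 1ℤ * (b - c)
    lemma = solve-∀

  +-cong-≈ : ∀ {a b c d} → a ≈ b → c ≈ d → a + c ≈ b + d
  +-cong-≈ {a} {b} {c} {d} e f = combination₂ 1ℤ 1ℤ e f (lemma a b c d)
    where
    lemma : ∀ a b c d → (a + c) - (b + d) ≡ 1ℤ * (a - b) + 1ℤ * (c - d)
    lemma = solve-∀

  *-cong-≈ : ∀ {a b c d} → a ≈ b → c ≈ d → a * c ≈ b * d
  *-cong-≈ {a} {b} {c} {d} e f = combination₂ c b e f (lemma a b c d)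
    where
    lemma : ∀ a b c d → a * c - b * d ≡ c * (a - b) + b * (c - d)
    lemma = solve-∀

  neg-cong-≈ : ∀ {a b} → a ≈ b → - a ≈ - b
  neg-cong-≈ {a} {b} e = combination₁ (- 1ℤ) e (lemma a b)
    where
    lemma : ∀ a b → (- a) - (- b) ≡ - 1ℤ * (a - b)
    lemma = solve-∀

  rep : Fin p → ℤ
  rep x = + toℕ x

  %ℕ-≈ : ∀ z → + (z %ℕ p) ≈ z
  %ℕ-≈ z = ≈-mk (divides (- (z /ℕ p)) (begin
    + (z %ℕ p) - z                                 ≡⟨ cong (λ y → + (z %ℕ p) - y) (a≡a%ℕn+[a/ℕn]*n z p) ⟩
    + (z %ℕ p) - (+ (z %ℕ p) + (z /ℕ p) * + p)     ≡⟨ lemma (+ (z %ℕ p)) (z /ℕ p) (+ p) ⟩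
    - (z /ℕ p) * + p                               ∎))
    where
    open ≡-Reasoning
    lemma : ∀ r q m → r - (r + q * m) ≡ - q * m
    lemma = solve-∀

  abstract
    -- Opaque, so that only `rep-red` is ever used and no integer division gets unfolded.
    red : ℤ → Fin p
    red z = fromℕ< (n%ℕd<d z p)

    rep-red : ∀ z → rep (red z) ≈ z
    rep-red z = subst (λ n → + n ≈ z) (sym (toℕ-fromℕ< (n%ℕd<d z p))) (%ℕ-≈ z)

  p∣⇒≈0 : ∀ {x} → + p ∣ x → x ≈ 0ℤ
  p∣⇒≈0 {x} d = ≈-mk (subst (+ p ∣_) (sym (ℤ.+-identityʳ x)) d)

  ≈0⇒p∣ : ∀ {x} → x ≈ 0ℤ → + p ∣ x
  ≈0⇒p∣ {x} (≈-mk d) = subst (+ p ∣_) (ℤ.+-identityʳ x) d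

  private
    ≤-unique : ∀ {m n} → m ≤ n → n < p → + m ≈ + n → m ≡ n
    ≤-unique {m} {n} m≤n n<p e with ℕ.m≤n⇒∃[o]m+o≡n m≤n
    ... | zero  , refl = sym (ℕ.+-identityʳ m)
    ... | suc k , refl = ⊥-elim (ℕ.<⇒≱ (ℕ.≤-<-trans (ℕ.m≤n+m (suc k) m) n<p)
      (ℕᵈ.∣⇒≤ (∣⇒∣ᵤ (≈0⇒p∣ {+ suc k} (combination₁ (- 1ℤ) e (lemma (+ m) (+ suc k)))))))
      where
      lemma : ∀ a b → b - 0ℤ ≡ - 1ℤ * (a - (a + b))
      lemma = solve-∀

  residue-unique : ∀ {m n} → m < p → n < p → + m ≈ + n → m ≡ n
  residue-unique {m} {n} m<p n<p e with ℕ.≤-total m n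
  ... | inj₁ m≤n = ≤-unique m≤n n<p e
  ... | inj₂ n≤m = sym (≤-unique n≤m m<p (≈-sym e))

  rep-injective : ∀ {x y} → rep x ≈ rep y → x ≡ y
  rep-injective {x} {y} e = toℕ-injective (residue-unique (toℕ<n x) (toℕ<n y) e)

  red-cong : ∀ {a b} → a ≈ b → red a ≡ red b
  red-cong {a} {b} e = rep-injective (≈-trans (rep-red a) (≈-trans e (≈-sym (rep-red b))))

  red-injective : ∀ {a b} → red a ≡ red b → a ≈ b
  red-injective {a} {b} eq =
    ≈-trans (≈-sym (rep-red a)) (subst (λ x → rep x ≈ b) (sym eq) (rep-red b))

  abstract
    -- Opaque, so that two quadrances are compared by their coordinates and the integer products are
    -- not unfolded. The coordinates do compute: `+ m + + n` reduces to `+ (m ℕ.+ n)`.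
    quadrance : ℤ → ℤ → ℤ
    quadrance x y = x * x + y * y

    quadrance-≡ : ∀ x y → quadrance x y ≡ x * x + y * y
    quadrance-≡ x y = refl

  private
    pos-quadrance : ∀ x y → + (x ℕ.* x ℕ.+ y ℕ.* y) ≡ quadrance (+ x) (+ y)
    pos-quadrance x y = trans (cong₂ _+_ (ℤ.pos-* x x) (ℤ.pos-* y y)) (sym (quadrance-≡ (+ x) (+ y)))

    quadN-≈ : ∀ x y → + quadN p x y ≈ quadrance (+ x) (+ y)
    quadN-≈ x y = ≈-trans (%ℕ-≈ (+ (x ℕ.* x ℕ.+ y ℕ.* y))) (≈-reflexive (pos-quadrance x y))

  quadN-sound : ∀ x y {K} → T (quadN p x y ≡ᵇ K) → quadrance (+ x) (+ y) ≈ + K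
  quadN-sound x y {K} t =
    subst (λ k → quadrance (+ x) (+ y) ≈ + k) (ℕ.≡ᵇ⇒≡ (quadN p x y) K t) (≈-sym (quadN-≈ x y))

  quadN-complete : ∀ x y {K} → K < p → quadrance (+ x) (+ y) ≈ + K → T (quadN p x y ≡ᵇ K)
  quadN-complete x y {K} K<p e =
    ℕ.≡⇒≡ᵇ (quadN p x y) K (residue-unique (m%n<n _ p) K<p (≈-trans (quadN-≈ x y) e))

  module Field (prime : Prime p) where
    integral : ∀ x y → x * y ≈ 0ℤ → x ≈ 0ℤ ⊎ y ≈ 0ℤ
    integral x y e with euclidsLemma ℤ.∣ x ∣ ℤ.∣ y ∣ prime (subst (p ℕᵈ.∣_) (ℤ.abs-* x y) (∣⇒∣ᵤ (≈0⇒p∣ e)))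
    ... | inj₁ dx = inj₁ (p∣⇒≈0 (∣ᵤ⇒∣ dx))
    ... | inj₂ dy = inj₂ (p∣⇒≈0 (∣ᵤ⇒∣ dy))

    square≈0 : ∀ x → x * x ≈ 0ℤ → x ≈ 0ℤ
    square≈0 x e with integral x x e
    ... | inj₁ d = d
    ... | inj₂ d = d

    *-cancelˡ-≈ : ∀ c {x y} → c ≉ 0ℤ → c * x ≈ c * y → x ≈ y
    *-cancelˡ-≈ c {x} {y} c≉0 e = cancel (integral c (x - y) (combination₁ 1ℤ e (lemma₁ c x y)))
      where
      lemma₁ : ∀ c x y → c * (x - y) - 0ℤ ≡ 1ℤ * (c * x - c * y)
      lemma₁ = solve-∀
      lemma₂ : ∀ x y → x - y ≡ 1ℤ * ((x - y) - 0ℤ)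
      lemma₂ = solve-∀
      cancel : c ≈ 0ℤ ⊎ x - y ≈ 0ℤ → x ≈ y
      cancel (inj₁ d) = ⊥-elim (c≉0 d)
      cancel (inj₂ d) = combination₁ 1ℤ d (lemma₂ x y)

    private
      rep-inverse : ∀ x → toℕ x ≢ 0 → ∃[ y ] (rep x * y ≈ 1ℤ)
      rep-inverse x x≢0 with toℕ x | toℕ<n x
      ... | zero  | _   = ⊥-elim (x≢0 refl)
      -- With x = `suc k`, Bézout's identity comes with either sign: 1 + b x = a p makes -b the
      -- inverse, 1 + a p = b x makes it b.
      ... | suc k | k<p with coprime-Bézout (prime⇒coprime prime k<p)
      ... | Bézout.+- a b eq = - + b , ≈-mk (divides (- + a) (begin
          + suc k * - + b - 1ℤ            ≡⟨ lemma (+ suc k) (+ b) ⟩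
          - (1ℤ + + b * + suc k)          ≡⟨ cong (λ z → - (1ℤ + z)) (ℤ.pos-* b (suc k)) ⟨
          - + (1 ℕ.+ b ℕ.* suc k)         ≡⟨ cong (λ n → - + n) eq ⟩
          - + (a ℕ.* p)                   ≡⟨ cong -_ (ℤ.pos-* a p) ⟩
          - (+ a * + p)                   ≡⟨ ℤ.neg-distribˡ-* (+ a) (+ p) ⟩
          - + a * + p                     ∎))
        where
        open ≡-Reasoning
        lemma : ∀ x y → x * - y - 1ℤ ≡ - (1ℤ + y * x)
        lemma = solve-∀
      ... | Bézout.-+ a b eq = + b , ≈-mk (divides (+ a) (begin
          + suc k * + b - 1ℤ              ≡⟨ cong (_- 1ℤ) (ℤ.*-comm (+ suc k) (+ b)) ⟩
          + b * + suc k - 1ℤ              ≡⟨ cong (_- 1ℤ) (ℤ.pos-* b (suc k)) ⟨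
          + (b ℕ.* suc k) - 1ℤ            ≡⟨ cong (λ n → + n - 1ℤ) eq ⟨
          + (1 ℕ.+ a ℕ.* p) - 1ℤ          ≡⟨ lemma (+ (a ℕ.* p)) ⟩
          + (a ℕ.* p)                     ≡⟨ ℤ.pos-* a p ⟩
          + a * + p                       ∎))
        where
        open ≡-Reasoning
        lemma : ∀ x → (1ℤ + x) - 1ℤ ≡ x
        lemma = solve-∀

    inverse : ∀ x → x ≉ 0ℤ → ∃[ y ] (x * y ≈ 1ℤ)
    inverse x x≉0 = y , ≈-trans (*-cong-≈ (≈-sym (rep-red x)) (≈-refl {y})) e
      where
      nonzero : toℕ (red x) ≢ 0
      nonzero eq = x≉0 (≈-trans (≈-sym (rep-red x)) (≈-reflexive (cong +_ eq)))
      y = proj₁ (rep-inverse (red x) nonzero)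
      e = proj₂ (rep-inverse (red x) nonzero)

    1≉0 : 1ℤ ≉ 0ℤ
    1≉0 e = ℕ.<⇒≱ (ℕ.nonTrivial⇒n>1 p {{prime⇒nonTrivial prime}}) (ℕᵈ.∣⇒≤ (∣⇒∣ᵤ (≈0⇒p∣ e)))

-- Geometry of the circles for p ≡ 3 (mod 4).

module Circle (p : ℕ) .{{nz : NonZero p}} (prime : Prime p) (p%4≡3 : p % 4 ≡ 3) where
  open import Data.Nat using (_≤_; _<_; z≤n; s≤s)
  open import Data.Integer using (+_; _+_; _-_; _*_; -_)
  open import Data.Integer.Tactic.RingSolver using (solve-∀)
  open Modular p
  open Field prime

  2≉0 : + 2 ≉ 0ℤ
  2≉0 e = small p p%4≡3 (ℕᵈ.∣⇒≤ (∣⇒∣ᵤ (≈0⇒p∣ e)))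
    where
    small : ∀ n → n % 4 ≡ 3 → n ≤ 2 → ⊥
    small zero ()
    small (suc zero) ()
    small (suc (suc zero)) ()
    small (suc (suc (suc n))) _ (s≤s (s≤s ()))

  2x≈0 : ∀ x → + 2 * x ≈ 0ℤ → x ≈ 0ℤ
  2x≈0 x e with integral (+ 2) x e
  ... | inj₁ d = ⊥-elim (2≉0 d)
  ... | inj₂ d = d

  0<p : 0 < p
  0<p = ℕ.>-nonZero⁻¹ p

  1<p : 1 < p
  1<p = ℕ.nonTrivial⇒n>1 p {{prime⇒nonTrivial prime}}

  rep≈0 : ∀ x → rep x ≈ 0ℤ → toℕ x ≡ 0
  rep≈0 x e = residue-unique (toℕ<n x) 0<p e

  -- -1 is not a square modulo p.

  abstract
    -- A choice of one element from each pair {a, −a} of nonzero residues.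
    isLow : ℤ → Bool
    isLow a = toℕ (red a) <ᵇ toℕ (red (- a))

    isLow-cong : ∀ {a b} → a ≈ b → isLow a ≡ isLow b
    isLow-cong e = cong₂ (λ x y → toℕ x <ᵇ toℕ y) (red-cong e) (red-cong (neg-cong-≈ e))

    isLow-neg : ∀ {a} → a ≉ 0ℤ → isLow (- a) ≡ not (isLow a)
    isLow-neg {a} a≉0 = trans (cong (λ z → toℕ (red (- a)) <ᵇ toℕ (red z)) (ℤ.neg-involutive a))
      (<ᵇ-flip (toℕ (red a)) (toℕ (red (- a))) λ eq → a≉0 (2x≈0 a
        (combination₁ 1ℤ (red-injective {a} {(- a)} (toℕ-injective eq)) (lemma a))))
      where
      lemma : ∀ a → + 2 * a - 0ℤ ≡ 1ℤ * (a - (- a))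
      lemma = solve-∀
      <ᵇ-flip : ∀ m n → m ≢ n → (n <ᵇ m) ≡ not (m <ᵇ n)
      <ᵇ-flip zero    zero    m≢n = ⊥-elim (m≢n refl)
      <ᵇ-flip zero    (suc n) m≢n = refl
      <ᵇ-flip (suc m) zero    m≢n = refl
      <ᵇ-flip (suc m) (suc n) m≢n = <ᵇ-flip m n (m≢n ∘ cong suc)

  -- If w² = −1 then x ↦ wx exchanges the nonzero x whose square is low with those whose square
  -- is high, and x ↦ −x halves each of these classes, so that 4 divides p − 1.
  module SqrtMinusOne (w : ℤ) (w²≈-1 : w * w ≈ - 1ℤ) where
    nonzero lowSquare : Fin p → Bool
    nonzero x = not (toℕ x ≡ᵇ 0)
    lowSquare x = isLow (rep x * rep x)

    nonzero-sound : ∀ x → T (nonzero x) → rep x ≉ 0ℤ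
    nonzero-sound x t e = T-not-elim t (ℕ.≡⇒≡ᵇ (toℕ x) 0 (rep≈0 x e))

    nonzero-complete : ∀ x → rep x ≉ 0ℤ → T (nonzero x)
    nonzero-complete x x≉0 = T-not-intro λ t → x≉0 (≈-reflexive (cong +_ (ℕ.≡ᵇ⇒≡ (toℕ x) 0 t)))

    w≉0 : w ≉ 0ℤ
    w≉0 e = 1≉0 (combination₂ 1ℤ (- w) w²≈-1 e (lemma w))
      where
      lemma : ∀ w → 1ℤ - 0ℤ ≡ 1ℤ * (w * w - (- 1ℤ)) + - w * (w - 0ℤ)
      lemma = solve-∀

    -1≉0 : - 1ℤ ≉ 0ℤ
    -1≉0 e = 1≉0 (combination₁ (- 1ℤ) e refl)

    times : ℤ → Fin p → Fin p
    times c x = red (c * rep x)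

    times-nonzero : ∀ c x → c ≉ 0ℤ → T (nonzero x) → T (nonzero (times c x))
    times-nonzero c x c≉0 t = nonzero-complete (times c x) λ e →
      absurd (integral c (rep x) (≈-trans (≈-sym (rep-red (c * rep x))) e))
      where
      absurd : ¬ (c ≈ 0ℤ ⊎ rep x ≈ 0ℤ)
      absurd (inj₁ e) = c≉0 e
      absurd (inj₂ e) = nonzero-sound x t e

    lowSquare-times : ∀ c d x → c * c ≈ d → lowSquare (times c x) ≡ isLow (d * (rep x * rep x))
    lowSquare-times c d x e = isLow-cong (≈-trans
      (*-cong-≈ (rep-red (c * rep x)) (rep-red (c * rep x)))
      (combination₁ (rep x * rep x) e (lemma c d (rep x))))
      where
      lemma : ∀ c d x → c * x * (c * x) - d * (x * x) ≡ x * x * (c * c - d)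
      lemma = solve-∀

    lowSquare-w : ∀ x → T (nonzero x) → lowSquare (times w x) ≡ not (lowSquare x)
    lowSquare-w x t = trans (lowSquare-times w (- 1ℤ) x w²≈-1)
      (trans (cong isLow (ℤ.-1*i≡-i (rep x * rep x)))
        (isLow-neg λ e → nonzero-sound x t (square≈0 (rep x) e)))

    lowSquare-neg : ∀ x → lowSquare (times (- 1ℤ) x) ≡ lowSquare x
    lowSquare-neg x = trans (lowSquare-times (- 1ℤ) 1ℤ x ≈-refl) (cong isLow (ℤ.*-identityˡ _))

    isLow-times-neg : ∀ x → T (nonzero x) → isLow (rep (times (- 1ℤ) x)) ≡ not (isLow (rep x))
    isLow-times-neg x t = trans
      (isLow-cong (≈-trans (rep-red (- 1ℤ * rep x)) (≈-reflexive (ℤ.-1*i≡-i (rep x)))))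
      (isLow-neg (nonzero-sound x t))

    lows highs lowLows lowHighs : Fin p → Bool
    lows  x = nonzero x ∧ lowSquare x
    highs x = nonzero x ∧ not (lowSquare x)
    lowLows  x = lows x ∧ isLow (rep x)
    lowHighs x = lows x ∧ not (isLow (rep x))

    #_ : (Fin p → Bool) → ℕ
    # P = count P (allFin p)

    #-≤ : ∀ P Q c → c ≉ 0ℤ → (∀ x → T (P x) → T (Q (times c x))) → # P ≤ # Q
    #-≤ P Q c c≉0 into = count-≤-inj P Q (times c) (allFin⁺ p) ∈-allFin into
      (λ x y _ _ eq → rep-injective (*-cancelˡ-≈ c c≉0 (red-injective {c * rep x} {c * rep y} eq)))

    lows≡highs : # lows ≡ # highs
    lows≡highs = ℕ.≤-antisym
      (#-≤ lows highs w w≉0 λ x t → let n , l = T-∧-elim {nonzero x} t in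
        T-∧-intro (times-nonzero w x w≉0 n) (subst (T ∘ not) (sym (lowSquare-w x n)) (T-not-not l)))
      (#-≤ highs lows w w≉0 λ x t → let n , h = T-∧-elim {nonzero x} t in
        T-∧-intro (times-nonzero w x w≉0 n) (subst T (sym (lowSquare-w x n)) h))

    lowLows≡lowHighs : # lowLows ≡ # lowHighs
    lowLows≡lowHighs = ℕ.≤-antisym
      (#-≤ lowLows lowHighs (- 1ℤ) -1≉0 λ x t →
        let nl , l = T-∧-elim {lows x} t ; n , s = T-∧-elim {nonzero x} nl in
        T-∧-intro (T-∧-intro (times-nonzero (- 1ℤ) x -1≉0 n) (subst T (sym (lowSquare-neg x)) s))
          (subst (T ∘ not) (sym (isLow-times-neg x n)) (T-not-not l)))
      (#-≤ lowHighs lowLows (- 1ℤ) -1≉0 λ x t →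
        let nl , l = T-∧-elim {lows x} t ; n , s = T-∧-elim {nonzero x} nl in
        T-∧-intro (T-∧-intro (times-nonzero (- 1ℤ) x -1≉0 n) (subst T (sym (lowSquare-neg x)) s))
          (subst T (sym (isLow-times-neg x n)) l))

    p≡1+4k : p ≡ 1 ℕ.+ # lowLows ℕ.* 4
    p≡1+4k = begin
      p                                        ≡⟨ length-allFin p ⟨
      length (allFin p)                        ≡⟨ count-all (allFin p) ⟨
      # (λ _ → true)                           ≡⟨ count-split (λ _ → true) (λ x → toℕ x ≡ᵇ 0) (allFin p) ⟩
      # (λ x → toℕ x ≡ᵇ 0) ℕ.+ # nonzero       ≡⟨ cong₂ ℕ._+_ one (count-split nonzero lowSquare (allFin p)) ⟩
      1 ℕ.+ (# lows ℕ.+ # highs)               ≡⟨ cong (λ n → 1 ℕ.+ (# lows ℕ.+ n)) lows≡highs ⟨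
      1 ℕ.+ (# lows ℕ.+ # lows)                ≡⟨ cong (λ n → 1 ℕ.+ (n ℕ.+ n))
        (trans (count-split lows (isLow ∘ rep) (allFin p)) (cong (# lowLows ℕ.+_) (sym lowLows≡lowHighs))) ⟩
      1 ℕ.+ ((# lowLows ℕ.+ # lowLows) ℕ.+ (# lowLows ℕ.+ # lowLows)) ≡⟨ cong suc (lemma (# lowLows)) ⟩
      1 ℕ.+ # lowLows ℕ.* 4                    ∎
      where
      open ≡-Reasoning
      lemma : ∀ n → (n ℕ.+ n) ℕ.+ (n ℕ.+ n) ≡ n ℕ.* 4
      lemma = ℕ-solver.solve-∀
      origin = fromℕ< 0<p
      one : # (λ x → toℕ x ≡ᵇ 0) ≡ 1
      one = count-unique (λ x → toℕ x ≡ᵇ 0) (allFin⁺ p) ∈-allFin origin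
        (ℕ.≡⇒≡ᵇ (toℕ origin) 0 (toℕ-fromℕ< 0<p))
        (λ x t → toℕ-injective (trans (ℕ.≡ᵇ⇒≡ (toℕ x) 0 t) (sym (toℕ-fromℕ< 0<p))))

    absurd : ⊥
    absurd = [1+k*4]%4≢3 (# lowLows) p≡1+4k
      where
      [1+k*4]%4≢3 : ∀ k → p ≡ 1 ℕ.+ k ℕ.* 4 → ⊥
      [1+k*4]%4≢3 k eq = ℕ.<⇒≢ {1} {3} (s≤s (s≤s z≤n))
        (trans (sym ([m+kn]%n≡m%n 1 k 4)) (trans (cong (_% 4) (sym eq)) p%4≡3))

  w²≉-1 : ∀ w → w * w ≉ - 1ℤ
  w²≉-1 = SqrtMinusOne.absurd

  -- If y were invertible, x / y would be a square root of -1.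
  anisotropic : ∀ x y → x * x + y * y ≈ 0ℤ → x ≈ 0ℤ × y ≈ 0ℤ
  anisotropic x y e = cases (+ p ∣? y)
    where
    lemma₁ : ∀ x y → x * x - 0ℤ ≡ 1ℤ * ((x * x + y * y) - 0ℤ) + - y * (y - 0ℤ)
    lemma₁ = solve-∀
    lemma₂ : ∀ x y z → x * z * (x * z) - (- 1ℤ) ≡ z * z * ((x * x + y * y) - 0ℤ) + - (y * z + 1ℤ) * (y * z - 1ℤ)
    lemma₂ = solve-∀
    cases : Dec (+ p ∣ y) → x ≈ 0ℤ × y ≈ 0ℤ
    cases (yes p∣y) = square≈0 x (combination₂ 1ℤ (- y) e (p∣⇒≈0 p∣y) (lemma₁ x y)) , p∣⇒≈0 p∣y
    cases (no p∤y) = ⊥-elim (w²≉-1 (x * z) (combination₂ (z * z) (- (y * z + 1ℤ)) e (proj₂ y⁻¹) (lemma₂ x y z)))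
      where
      y⁻¹ = inverse y (p∤y ∘ ≈0⇒p∣)
      z = proj₁ y⁻¹

  -- Sizes of the circles.

  OnCircle : ℕ → Pt p → Set
  OnCircle K z = rep (proj₁ z) * rep (proj₁ z) + rep (proj₂ z) * rep (proj₂ z) ≈ + K

  inC-sound : ∀ K z → T (inC p K z) → OnCircle K z
  inC-sound K z t = subst (_≈ + K) (quadrance-≡ (rep (proj₁ z)) (rep (proj₂ z)))
    (quadN-sound (toℕ (proj₁ z)) (toℕ (proj₂ z)) t)

  inC-complete : ∀ K z → K < p → OnCircle K z → T (inC p K z)
  inC-complete K z K<p e = quadN-complete (toℕ (proj₁ z)) (toℕ (proj₂ z)) K<p
    (subst (_≈ + K) (sym (quadrance-≡ (rep (proj₁ z)) (rep (proj₂ z)))) e)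

  pt-≡ : ∀ {z z′ : Pt p} → rep (proj₁ z) ≈ rep (proj₁ z′) → rep (proj₂ z) ≈ rep (proj₂ z′) → z ≡ z′
  pt-≡ e f = cong₂ _,_ (rep-injective e) (rep-injective f)

  pts-unique : Unique (pts p)
  pts-unique = cartesianProduct⁺ (allFin⁺ p) (allFin⁺ p)

  pts-full : ∀ z → z ∈ pts p
  pts-full (u , v) = ∈-cartesianProduct⁺ (∈-allFin u) (∈-allFin v)

  pairs-unique : Unique (cartesianProduct (pts p) (pts p))
  pairs-unique = cartesianProduct⁺ pts-unique pts-unique

  pairs-full : ∀ z → z ∈ cartesianProduct (pts p) (pts p)
  pairs-full (a , b) = ∈-cartesianProduct⁺ (pts-full a) (pts-full b)

  cardC-0 : cardC p 0 ≡ 1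
  cardC-0 = count-unique (inC p 0) pts-unique pts-full (red 0ℤ , red 0ℤ)
    (inC-complete 0 (red 0ℤ , red 0ℤ) 0<p
      (+-cong-≈ (*-cong-≈ (rep-red 0ℤ) (rep-red 0ℤ)) (*-cong-≈ (rep-red 0ℤ) (rep-red 0ℤ))))
    (λ z t → let e , f = anisotropic (rep (proj₁ z)) (rep (proj₂ z)) (inC-sound 0 z t) in
      pt-≡ (≈-trans e (≈-sym (rep-red 0ℤ))) (≈-trans f (≈-sym (rep-red 0ℤ))))

  -- The points of the circle of quadrance r² are parametrised by the slopes of the lines through (−r, 0).
  module Slope (r : ℤ) (K : ℕ) (r²≈K : r * r ≈ + K) where
    -- `Fin.zero` stands for infinite slope and is assigned to the base point (-r, 0) itself; the
    -- other p indices are the finite slopes.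
    data SlopeView (u v : ℤ) : Fin (suc p) → Set where
      vertical : u + r ≈ 0ℤ → SlopeView u v Fin.zero
      slope    : ∀ t → u + r ≉ 0ℤ → rep t * (u + r) ≈ v → SlopeView u v (Fin.suc t)

    slopeView : ∀ u v → ∃[ s ] SlopeView u v s
    slopeView u v = cases (+ p ∣? u + r)
      where
      cases : Dec (+ p ∣ u + r) → ∃[ s ] SlopeView u v s
      cases (yes d) = Fin.zero , vertical (p∣⇒≈0 d)
      cases (no ¬d) = Fin.suc (red (v * y)) , slope (red (v * y)) (¬d ∘ ≈0⇒p∣)
        (combination₂ (u + r) v (rep-red (v * y)) (proj₂ x⁻¹) (lemma (rep (red (v * y))) (u + r) v y))
        where
        x⁻¹ = inverse (u + r) (¬d ∘ ≈0⇒p∣)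
        y = proj₁ x⁻¹
        lemma : ∀ t x v y → t * x - v ≡ x * (t - v * y) + v * (x * y - 1ℤ)
        lemma = solve-∀

    vertical-v : ∀ u v → u * u + v * v ≈ + K → u + r ≈ 0ℤ → v ≈ 0ℤ
    vertical-v u v e f = square≈0 v (combination₃ 1ℤ (- 1ℤ) (r - u) e r²≈K f (lemma u v r (+ K)))
      where
      lemma : ∀ u v r k → v * v - 0ℤ ≡ 1ℤ * ((u * u + v * v) - k) + - 1ℤ * (r * r - k) + (r - u) * ((u + r) - 0ℤ)
      lemma = solve-∀

    -- Subtracting r² = K from u² + v² = K with v = t (u + r) gives (u + r) ((u - r) + t² (u + r)) =
    -- 0; cancel u + r. As 1 + t² is invertible, the slope determines u, and then v.
    slope-u : ∀ u v t → u * u + v * v ≈ + K → u + r ≉ 0ℤ → t * (u + r) ≈ v → (1ℤ + t * t) * (u + r) ≈ + 2 * r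
    slope-u u v t e x≉0 f = *-cancelˡ-≈ (u + r) x≉0
      (combination₃ 1ℤ (- 1ℤ) (t * (u + r) + v) e r²≈K f (lemma u v t r (+ K)))
      where
      lemma : ∀ u v t r k → (u + r) * ((1ℤ + t * t) * (u + r)) - (u + r) * (+ 2 * r) ≡
        1ℤ * ((u * u + v * v) - k) + - 1ℤ * (r * r - k) + (t * (u + r) + v) * (t * (u + r) - v)
      lemma = solve-∀

    1+t²≉0 : ∀ t → 1ℤ + t * t ≉ 0ℤ
    1+t²≉0 t e = w²≉-1 t (combination₁ 1ℤ e (lemma t))
      where
      lemma : ∀ t → t * t - (- 1ℤ) ≡ 1ℤ * ((1ℤ + t * t) - 0ℤ)
      lemma = solve-∀

    view-injective : ∀ (z z′ : Pt p) {s} → OnCircle K z → OnCircle K z′ →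
      SlopeView (rep (proj₁ z)) (rep (proj₂ z)) s → SlopeView (rep (proj₁ z′)) (rep (proj₂ z′)) s → z ≡ z′
    view-injective z z′ e e′ (vertical f) (vertical f′) = pt-≡
      (combination₂ 1ℤ (- 1ℤ) f f′ (lemma (rep (proj₁ z)) (rep (proj₁ z′)) r))
      (≈-trans (vertical-v (rep (proj₁ z)) (rep (proj₂ z)) e f)
        (≈-sym (vertical-v (rep (proj₁ z′)) (rep (proj₂ z′)) e′ f′)))
      where
      lemma : ∀ u u′ r → u - u′ ≡ 1ℤ * ((u + r) - 0ℤ) + - 1ℤ * ((u′ + r) - 0ℤ)
      lemma = solve-∀
    view-injective z z′ e e′ (slope t x≉0 f) (slope .t x′≉0 f′) = pt-≡
      (combination₁ 1ℤ x≈x′ (lemma (rep (proj₁ z)) (rep (proj₁ z′)) r))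
      (≈-trans (≈-sym f) (≈-trans (*-cong-≈ (≈-refl {rep t}) x≈x′) f′))
      where
      x≈x′ : rep (proj₁ z) + r ≈ rep (proj₁ z′) + r
      x≈x′ = *-cancelˡ-≈ (1ℤ + rep t * rep t) (1+t²≉0 (rep t))
        (≈-trans (slope-u (rep (proj₁ z)) (rep (proj₂ z)) (rep t) e x≉0 f)
          (≈-sym (slope-u (rep (proj₁ z′)) (rep (proj₂ z′)) (rep t) e′ x′≉0 f′)))
      lemma : ∀ u u′ r → u - u′ ≡ 1ℤ * ((u + r) - (u′ + r))
      lemma = solve-∀

    cardC-square-≤ : cardC p K ≤ suc p
    cardC-square-≤ = ℕ.≤-trans
      (count-≤-inj (inC p K) (λ _ → true) φ {ys = allFin (suc p)} pts-unique ∈-allFin (λ _ _ → tt)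
        (λ z z′ t t′ eq → view-injective z z′ (inC-sound K z t) (inC-sound K z′ t′)
          (view z) (subst (SlopeView (rep (proj₁ z′)) (rep (proj₂ z′))) (sym eq) (view z′))))
      (ℕ.≤-reflexive (trans (count-all (allFin (suc p))) (length-allFin (suc p))))
      where
      φ : Pt p → Fin (suc p)
      φ z = proj₁ (slopeView (rep (proj₁ z)) (rep (proj₂ z)))
      view : ∀ z → SlopeView (rep (proj₁ z)) (rep (proj₂ z)) (φ z)
      view z = proj₂ (slopeView (rep (proj₁ z)) (rep (proj₂ z)))

  -- Multiplication by the conjugate of a point of C_K embeds C_K into C_{K²}.
  cardC-≤ : ∀ K → K < p → K ≢ 0 → cardC p K ≤ suc p
  cardC-≤ K K<p K≢0 = cases (0 ℕ.<? cardC p K)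
    where
    K≉0 : + K ≉ 0ℤ
    K≉0 e = K≢0 (residue-unique K<p 0<p e)
    cases : Dec (0 < cardC p K) → cardC p K ≤ suc p
    cases (no ¬pos) = ℕ.≤-trans (ℕ.≮⇒≥ ¬pos) z≤n
    cases (yes pos) = ℕ.≤-trans
      (count-≤-inj (inC p K) (inC p K²) φ pts-unique pts-full
        (λ z t → inC-complete K² (φ z) (toℕ<n (red (+ K * + K))) (onSquare z (inC-sound K z t)))
        (λ z z′ _ _ eq → injective z z′ eq))
      (Slope.cardC-square-≤ (+ K) K² (≈-sym (rep-red (+ K * + K))))
      where
      K² = toℕ (red (+ K * + K))
      witness = count-witness (inC p K) (pts p) pos
      a = rep (proj₁ (proj₁ witness))
      b = rep (proj₂ (proj₁ witness))
      ab : a * a + b * b ≈ + K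
      ab = inC-sound K (proj₁ witness) (proj₂ witness)
      re im : Pt p → ℤ
      re z = a * rep (proj₁ z) + b * rep (proj₂ z)
      im z = a * rep (proj₂ z) - b * rep (proj₁ z)
      φ : Pt p → Pt p
      φ z = red (re z) , red (im z)
      brahmagupta : ∀ a b u v → (a * u + b * v) * (a * u + b * v) + (a * v - b * u) * (a * v - b * u)
        ≡ (a * a + b * b) * (u * u + v * v)
      brahmagupta = solve-∀
      onSquare : ∀ z → OnCircle K z → OnCircle K² (φ z)
      onSquare z e = ≈-trans
        (+-cong-≈ (*-cong-≈ (rep-red (re z)) (rep-red (re z))) (*-cong-≈ (rep-red (im z)) (rep-red (im z))))
        (≈-trans (≈-reflexive (brahmagupta a b (rep (proj₁ z)) (rep (proj₂ z))))
          (≈-trans (*-cong-≈ ab e) (≈-sym (rep-red (+ K * + K)))))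
      -- The map is linear in `z` with determinant a² + b² = K, which is nonzero: K u = a re - b im
      -- and K v = b re + a im.
      injective : ∀ z z′ → φ z ≡ φ z′ → z ≡ z′
      injective z z′ eq = pt-≡
        (*-cancelˡ-≈ (+ K) K≉0 (combination₃ (u′ - u) a (- b) ab reEq imEq (lemma₁ a b u v u′ v′ (+ K))))
        (*-cancelˡ-≈ (+ K) K≉0 (combination₃ (v′ - v) b a ab reEq imEq (lemma₂ a b u v u′ v′ (+ K))))
        where
        u = rep (proj₁ z)
        v = rep (proj₂ z)
        u′ = rep (proj₁ z′)
        v′ = rep (proj₂ z′)
        reEq : a * u + b * v ≈ a * u′ + b * v′
        reEq = red-injective (cong proj₁ eq)
        imEq : a * v - b * u ≈ a * v′ - b * u′
        imEq = red-injective (cong proj₂ eq)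
        lemma₁ : ∀ a b u v u′ v′ k → k * u - k * u′ ≡ (u′ - u) * ((a * a + b * b) - k)
          + a * ((a * u + b * v) - (a * u′ + b * v′)) + - b * ((a * v - b * u) - (a * v′ - b * u′))
        lemma₁ = solve-∀
        lemma₂ : ∀ a b u v u′ v′ k → k * v - k * v′ ≡ (v′ - v) * ((a * a + b * b) - k)
          + b * ((a * u + b * v) - (a * u′ + b * v′)) + a * ((a * v - b * u) - (a * v′ - b * u′))
        lemma₂ = solve-∀

  quadPt : Pt p → ℕ
  quadPt z = quadN p (toℕ (proj₁ z)) (toℕ (proj₂ z))

  quadPt<p : ∀ z → quadPt z < p
  quadPt<p z = m%n<n _ p

  cardC-total : sumℕ (allFin p) (λ j → cardC p (toℕ j)) ≡ p ℕ.* p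
  cardC-total = trans (sumℕ-fibres p (λ _ → true) quadPt quadPt<p (pts p))
    (trans (count-cartesianProduct (λ _ → true) (λ _ → true) (allFin p) (allFin p))
      (cong₂ ℕ._*_ size size))
    where
    size : count (λ _ → true) (allFin p) ≡ p
    size = trans (count-all (allFin p)) (length-allFin p)

  -- No circle is bounded from below on its own: the p² points of the plane fill all the upper
  -- bounds of `cardC-≤` at once.
  cardC-≡ : ∀ (j : Fin p) → toℕ j ≢ 0 → cardC p (toℕ j) ≡ suc p
  cardC-≡ = sumℕ-tight-off-zero p (λ j → cardC p (toℕ j)) (λ j j≡0 → trans (cong (cardC p) j≡0) cardC-0)
    (λ j j≢0 → cardC-≤ (toℕ j) (toℕ<n j) j≢0) cardC-total

  cardC-1 : cardC p 1 ≡ suc p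
  cardC-1 = subst (λ k → cardC p k ≡ suc p) (toℕ-fromℕ< 1<p)
    (cardC-≡ (fromℕ< 1<p) λ eq → ℕ.1+n≢0 (trans (sym (toℕ-fromℕ< 1<p)) eq))

  -- Row sums, column sums and an upper bound for the step counts.

  sumPt : Pt p × Pt p → ℕ
  sumPt ((u₁ , v₁) , (u₂ , v₂)) = quadN p (toℕ u₁ ℕ.+ toℕ u₂) (toℕ v₁ ℕ.+ toℕ v₂)

  SumOnCircle : ℕ → Pt p → Pt p → Set
  SumOnCircle k (u₁ , v₁) (u₂ , v₂) =
    (rep u₁ + rep u₂) * (rep u₁ + rep u₂) + (rep v₁ + rep v₂) * (rep v₁ + rep v₂) ≈ + k

  sumPt-sound : ∀ k a b → T (sumPt (a , b) ≡ᵇ k) → SumOnCircle k a b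
  sumPt-sound k (u₁ , v₁) (u₂ , v₂) t = subst (_≈ + k) (quadrance-≡ (rep u₁ + rep u₂) (rep v₁ + rep v₂))
    (quadN-sound (toℕ u₁ ℕ.+ toℕ u₂) (toℕ v₁ ℕ.+ toℕ v₂) t)

  sumPt-complete : ∀ k a b → k < p → SumOnCircle k a b → T (sumPt (a , b) ≡ᵇ k)
  sumPt-complete k (u₁ , v₁) (u₂ , v₂) k<p e = quadN-complete (toℕ u₁ ℕ.+ toℕ u₂) (toℕ v₁ ℕ.+ toℕ v₂) k<p
    (subst (_≈ + k) (sym (quadrance-≡ (rep u₁ + rep u₂) (rep v₁ + rep v₂))) e)

  -- The local predicate of `Ncount` with its second circle fixed to C₁, in terms of projections so
  -- that its conjuncts can be regrouped.
  pairTest : ℕ → ℕ → Pt p × Pt p → Bool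
  pairTest i k z = inC p i (proj₁ z) ∧ inC p 1 (proj₂ z) ∧ (sumPt z ≡ᵇ k)

  Ncount-≡ : ∀ i k → Ncount p i 1 k ≡ count (pairTest i k) (cartesianProduct (pts p) (pts p))
  Ncount-≡ i k = count-cong (λ { ((u₁ , v₁) , (u₂ , v₂)) → refl }) (cartesianProduct (pts p) (pts p))

  Ncount-row : ∀ i → sumℕ (allFin p) (λ k → Ncount p i 1 (toℕ k)) ≡ cardC p i ℕ.* cardC p 1
  Ncount-row i = begin
    sumℕ (allFin p) (λ k → Ncount p i 1 (toℕ k))
      ≡⟨ sumℕ-cong (allFin p) (λ k → trans (Ncount-≡ i (toℕ k))
          (count-cong (λ z → sym (∧-assoc (inC p i (proj₁ z)) (inC p 1 (proj₂ z)) (sumPt z ≡ᵇ toℕ k))) (cartesianProduct (pts p) (pts p)))) ⟩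
    sumℕ (allFin p) (λ k → count (λ z → (inC p i (proj₁ z) ∧ inC p 1 (proj₂ z)) ∧ (sumPt z ≡ᵇ toℕ k)) (cartesianProduct (pts p) (pts p)))
      ≡⟨ sumℕ-fibres p (λ z → inC p i (proj₁ z) ∧ inC p 1 (proj₂ z)) sumPt (λ _ → m%n<n _ p) (cartesianProduct (pts p) (pts p)) ⟩
    count (λ z → inC p i (proj₁ z) ∧ inC p 1 (proj₂ z)) (cartesianProduct (pts p) (pts p))
      ≡⟨ count-cartesianProduct (inC p i) (inC p 1) (pts p) (pts p) ⟩
    cardC p i ℕ.* cardC p 1 ∎
    where open ≡-Reasoning

  module Column (k : Fin p) where
    K = toℕ k
    P Q : Pt p × Pt p → Bool
    P z = inC p 1 (proj₂ z) ∧ (sumPt z ≡ᵇ K)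
    Q z = inC p 1 (proj₁ z) ∧ inC p K (proj₂ z)

    to from : Pt p × Pt p → Pt p × Pt p
    to   ((u₁ , v₁) , (u₂ , v₂)) = (u₂ , v₂) , (red (rep u₁ + rep u₂) , red (rep v₁ + rep v₂))
    from ((u₁ , v₁) , (u₂ , v₂)) = (red (rep u₂ - rep u₁) , red (rep v₂ - rep v₁)) , (u₁ , v₁)

    cancel-+ : ∀ x y c → x + c ≈ y + c → x ≈ y
    cancel-+ x y c e = combination₁ 1ℤ e (lemma x y c)
      where
      lemma : ∀ x y c → x - y ≡ 1ℤ * ((x + c) - (y + c))
      lemma = solve-∀

    difference : ∀ a c → rep (red (c - a)) + a ≈ c
    difference a c = combination₁ 1ℤ (rep-red (c - a)) (lemma (rep (red (c - a))) a c)
      where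
      lemma : ∀ r a c → (r + a) - c ≡ 1ℤ * (r - (c - a))
      lemma = solve-∀

    to-into : ∀ z → T (P z) → T (Q (to z))
    to-into z@((u₁ , v₁) , (u₂ , v₂)) t = T-∧-intro (proj₁ st)
      (inC-complete K (proj₂ (to z)) (toℕ<n k) (≈-trans
        (+-cong-≈ (*-cong-≈ (rep-red (rep u₁ + rep u₂)) (rep-red (rep u₁ + rep u₂)))
                  (*-cong-≈ (rep-red (rep v₁ + rep v₂)) (rep-red (rep v₁ + rep v₂))))
        (sumPt-sound K (u₁ , v₁) (u₂ , v₂) (proj₂ st))))
      where st = T-∧-elim {inC p 1 (u₂ , v₂)} t

    from-into : ∀ z → T (Q z) → T (P (from z))
    from-into z@((u₁ , v₁) , (u₂ , v₂)) t = T-∧-intro (proj₁ st)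
      (sumPt-complete K (proj₁ (from z)) (u₁ , v₁) (toℕ<n k) (≈-trans
        (+-cong-≈ (*-cong-≈ (difference (rep u₁) (rep u₂)) (difference (rep u₁) (rep u₂)))
                  (*-cong-≈ (difference (rep v₁) (rep v₂)) (difference (rep v₁) (rep v₂))))
        (inC-sound K (u₂ , v₂) (proj₂ st))))
      where st = T-∧-elim {inC p 1 (u₁ , v₁)} t

    to-injective : ∀ z z′ → to z ≡ to z′ → z ≡ z′
    to-injective ((u₁ , v₁) , b) ((u₁′ , v₁′) , b′) eq = cong₂ _,_
      (pt-≡ {u₁ , v₁} {u₁′ , v₁′}
        (cancel-+ (rep u₁) (rep u₁′) (rep (proj₁ b′))
          (≈-trans (+-cong-≈ (≈-refl {rep u₁}) (≈-reflexive (cong (rep ∘ proj₁ ∘ proj₁) (sym eq))))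
            (red-injective (cong (proj₁ ∘ proj₂) eq))))
        (cancel-+ (rep v₁) (rep v₁′) (rep (proj₂ b′))
          (≈-trans (+-cong-≈ (≈-refl {rep v₁}) (≈-reflexive (cong (rep ∘ proj₂ ∘ proj₁) (sym eq))))
            (red-injective (cong (proj₂ ∘ proj₂) eq)))))
      (cong proj₁ eq)

    from-injective : ∀ z z′ → from z ≡ from z′ → z ≡ z′
    from-injective (b , (u₂ , v₂)) (b′ , (u₂′ , v₂′)) eq = cong₂ _,_ (cong proj₂ eq)
      (pt-≡ {u₂ , v₂} {u₂′ , v₂′}
        (cancel-+ (rep u₂) (rep u₂′) (- rep (proj₁ b′))
          (≈-trans (+-cong-≈ (≈-refl {rep u₂}) (neg-cong-≈ (≈-reflexive (cong (rep ∘ proj₁ ∘ proj₂) (sym eq)))))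
            (red-injective (cong (proj₁ ∘ proj₁) eq))))
        (cancel-+ (rep v₂) (rep v₂′) (- rep (proj₂ b′))
          (≈-trans (+-cong-≈ (≈-refl {rep v₂}) (neg-cong-≈ (≈-reflexive (cong (rep ∘ proj₂ ∘ proj₂) (sym eq)))))
            (red-injective (cong (proj₂ ∘ proj₁) eq)))))

    count-P : count P (cartesianProduct (pts p) (pts p)) ≡ cardC p 1 ℕ.* cardC p K
    count-P = trans
      (ℕ.≤-antisym
        (count-≤-inj P Q to pairs-unique pairs-full to-into (λ z z′ _ _ → to-injective z z′))
        (count-≤-inj Q P from pairs-unique pairs-full from-into (λ z z′ _ _ → from-injective z z′)))
      (count-cartesianProduct (inC p 1) (inC p K) (pts p) (pts p))

  -- Summing over `i` leaves `a` free, and (a, b) ↦ (b, a + b) then matches the pairs counted with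
  -- C₁ × C_k. This is what makes `π` stationary.
  Ncount-column : ∀ (k : Fin p) →
    sumℕ (allFin p) (λ i → Ncount p (toℕ i) 1 (toℕ k)) ≡ cardC p 1 ℕ.* cardC p (toℕ k)
  Ncount-column k = begin
    sumℕ (allFin p) (λ i → Ncount p (toℕ i) 1 (toℕ k))
      ≡⟨ sumℕ-cong (allFin p) (λ i → trans (Ncount-≡ (toℕ i) (toℕ k))
          (count-cong (λ z → ∧-comm (inC p (toℕ i) (proj₁ z)) (P z)) (cartesianProduct (pts p) (pts p)))) ⟩
    sumℕ (allFin p) (λ i → count (λ z → P z ∧ (quadPt (proj₁ z) ≡ᵇ toℕ i)) (cartesianProduct (pts p) (pts p)))
      ≡⟨ sumℕ-fibres p P (quadPt ∘ proj₁) (quadPt<p ∘ proj₁) (cartesianProduct (pts p) (pts p)) ⟩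
    count P (cartesianProduct (pts p) (pts p)) ≡⟨ count-P ⟩
    cardC p 1 ℕ.* cardC p (toℕ k) ∎
    where
    open ≡-Reasoning
    open Column k

  pairTest-sound : ∀ i k z → T (pairTest i k z) →
    OnCircle i (proj₁ z) × OnCircle 1 (proj₂ z) × SumOnCircle k (proj₁ z) (proj₂ z)
  pairTest-sound i k z t = inC-sound i (proj₁ z) (proj₁ st) , inC-sound 1 (proj₂ z) (proj₁ tu) ,
    sumPt-sound k (proj₁ z) (proj₂ z) (proj₂ tu)
    where
    st = T-∧-elim {inC p i (proj₁ z)} t
    tu = T-∧-elim {inC p 1 (proj₂ z)} (proj₂ st)

  -- By anisotropy a sum of quadrance 0 is the zero vector, so b = -a is determined by a.
  Ncount-zero-≤ : ∀ i → Ncount p i 1 0 ≤ cardC p i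
  Ncount-zero-≤ i = ℕ.≤-trans (ℕ.≤-reflexive (Ncount-≡ i 0))
    (count-≤-inj (pairTest i 0) (inC p i) proj₁ pairs-unique pts-full
      (λ z t → proj₁ (T-∧-elim {inC p i (proj₁ z)} t)) injective)
    where
    opposite : ∀ z → T (pairTest i 0 z) →
      (rep (proj₁ (proj₁ z)) + rep (proj₁ (proj₂ z)) ≈ 0ℤ) × (rep (proj₂ (proj₁ z)) + rep (proj₂ (proj₂ z)) ≈ 0ℤ)
    opposite z t = anisotropic _ _ (proj₂ (proj₂ (pairTest-sound i 0 z t)))
    cancel : ∀ {a a′ b b′} → a ≡ a′ → a + b ≈ 0ℤ → a′ + b′ ≈ 0ℤ → b ≈ b′
    cancel {a} {.a} {b} {b′} refl e e′ = combination₂ 1ℤ (- 1ℤ) e e′ (lemma a b b′)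
      where
      lemma : ∀ a b b′ → b - b′ ≡ 1ℤ * ((a + b) - 0ℤ) + - 1ℤ * ((a + b′) - 0ℤ)
      lemma = solve-∀
    injective : ∀ z z′ → T (pairTest i 0 z) → T (pairTest i 0 z′) → proj₁ z ≡ proj₁ z′ → z ≡ z′
    injective z z′ t t′ eq = cong₂ _,_ eq (pt-≡
      (cancel (cong (rep ∘ proj₁) eq) (proj₁ (opposite z t)) (proj₁ (opposite z′ t′)))
      (cancel (cong (rep ∘ proj₂) eq) (proj₂ (opposite z t)) (proj₂ (opposite z′ t′))))

  -- Rotations, translation by (1, 0) and common neighbours.

  Translate : ℕ → Pt p → Set
  Translate k (u , v) = (rep u + 1ℤ) * (rep u + 1ℤ) + rep v * rep v ≈ + k

  -- Rotating the configuration a + (1, 0) by the points of C₁ gives |C₁| configurations.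
  Ncount-≥ : ∀ i k a → i < p → k < p → OnCircle i a → Translate k a → suc p ≤ Ncount p i 1 k
  Ncount-≥ i k (u , v) i<p k<p ai ak = ℕ.≤-trans (ℕ.≤-reflexive (sym cardC-1)) (ℕ.≤-trans
    (count-≤-inj (inC p 1) (pairTest i k) φ pts-unique pairs-full into (λ _ _ _ _ eq → cong proj₂ eq))
    (ℕ.≤-reflexive (sym (Ncount-≡ i k))))
    where
    a b : ℤ
    a = rep u
    b = rep v
    re im : Pt p → ℤ
    re (c , d) = rep c * a - rep d * b
    im (c , d) = rep c * b + rep d * a
    φ : Pt p → Pt p × Pt p
    φ g = (red (re g) , red (im g)) , g
    rotated : ∀ a b c d → (c * a - d * b) * (c * a - d * b) + (c * b + d * a) * (c * b + d * a)
      ≡ (c * c + d * d) * (a * a + b * b)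
    rotated = solve-∀
    rotated-sum : ∀ a b c d →
      (c * a - d * b + c) * (c * a - d * b + c) + (c * b + d * a + d) * (c * b + d * a + d)
      ≡ (c * c + d * d) * ((a + 1ℤ) * (a + 1ℤ) + b * b)
    rotated-sum = solve-∀
    into : ∀ g → T (inC p 1 g) → T (pairTest i k (φ g))
    into g@(c , d) t = T-∧-intro
      (inC-complete i (red (re g) , red (im g)) i<p (≈-trans
        (+-cong-≈ (*-cong-≈ re≈ re≈) (*-cong-≈ im≈ im≈))
        (≈-trans (≈-reflexive (rotated a b (rep c) (rep d)))
          (≈-trans (*-cong-≈ g1 ai) (≈-reflexive (ℤ.*-identityˡ (+ i)))))))
      (T-∧-intro t (sumPt-complete k (red (re g) , red (im g)) g k<p (≈-trans
        (+-cong-≈ (*-cong-≈ re+c re+c) (*-cong-≈ im+d im+d))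
        (≈-trans (≈-reflexive (rotated-sum a b (rep c) (rep d)))
          (≈-trans (*-cong-≈ g1 ak) (≈-reflexive (ℤ.*-identityˡ (+ k))))))))
      where
      g1 : rep c * rep c + rep d * rep d ≈ 1ℤ
      g1 = inC-sound 1 g t
      re≈ = rep-red (re g)
      im≈ = rep-red (im g)
      re+c = +-cong-≈ re≈ (≈-refl {rep c})
      im+d = +-cong-≈ im≈ (≈-refl {rep d})

  translate : Pt p → ℕ
  translate (u , v) = quadN p (toℕ u ℕ.+ 1) (toℕ v)

  fibre : ℕ → ℕ → Pt p → Bool
  fibre i k z = inC p i z ∧ (translate z ≡ᵇ k)

  fibre-sound : ∀ i k z → T (fibre i k z) → OnCircle i z × Translate k z
  fibre-sound i k z@(u , v) t = inC-sound i z (proj₁ st) ,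
    subst (_≈ + k) (quadrance-≡ (rep u + 1ℤ) (rep v)) (quadN-sound (toℕ u ℕ.+ 1) (toℕ v) (proj₂ st))
    where st = T-∧-elim {inC p i z} t

  -- Equal squares leave x = y or x = -y, and `isLow` tells a nonzero residue from its negative. At
  -- 0, where `isLow` cannot separate them, the two alternatives agree.
  square-≈ : ∀ x y → x * x ≈ y * y → isLow x ≡ isLow y → x ≈ y
  square-≈ x y e low = cases (integral (x - y) (x + y) (combination₁ 1ℤ e (lemma₁ x y)))
    where
    lemma₁ : ∀ x y → (x - y) * (x + y) - 0ℤ ≡ 1ℤ * (x * x - y * y)
    lemma₁ = solve-∀
    lemma₂ : ∀ x y → x - y ≡ 1ℤ * ((x - y) - 0ℤ)
    lemma₂ = solve-∀
    lemma₃ : ∀ x y → x - (- y) ≡ 1ℤ * ((x + y) - 0ℤ)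
    lemma₃ = solve-∀
    not-fixed : ∀ b → b ≢ not b
    not-fixed true ()
    not-fixed false ()
    cases : x - y ≈ 0ℤ ⊎ x + y ≈ 0ℤ → x ≈ y
    cases (inj₁ d) = combination₁ 1ℤ d (lemma₂ x y)
    cases (inj₂ d) = zero? (+ p ∣? y)
      where
      x≈-y : x ≈ - y
      x≈-y = combination₁ 1ℤ d (lemma₃ x y)
      zero? : Dec (+ p ∣ y) → x ≈ y
      zero? (yes q) = ≈-trans x≈-y (≈-trans (neg-cong-≈ (p∣⇒≈0 q)) (≈-sym (p∣⇒≈0 q)))
      zero? (no ¬q) = ⊥-elim (not-fixed (isLow y)
        (trans (sym low) (trans (isLow-cong x≈-y) (isLow-neg (¬q ∘ ≈0⇒p∣)))))

  -- Subtracting u² + v² = i from (u + 1)² + v² = k gives 2u = k - i - 1. Thus u and v² are fixed,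
  -- and one Boolean, `isLow` of v, singles out the root.
  fibre-≤2 : ∀ i k → count (fibre i k) (pts p) ≤ 2
  fibre-≤2 i k = count-≤-inj (fibre i k) (λ _ → true) (λ z → isLow (rep (proj₂ z))) {ys = true ∷ false ∷ []}
    pts-unique (λ { true → here refl ; false → there (here refl) }) (λ _ _ → tt) injective
    where
    injective : ∀ z z′ → T (fibre i k z) → T (fibre i k z′) →
      isLow (rep (proj₂ z)) ≡ isLow (rep (proj₂ z′)) → z ≡ z′
    injective z z′ t t′ low = pt-≡ u≈u′ (square-≈ v v′
      (combination₃ 1ℤ (- 1ℤ) (- (u + u′)) e e′ u≈u′ (lemma₂ u v u′ v′ (+ i))) low)
      where
      u = rep (proj₁ z)
      v = rep (proj₂ z)
      u′ = rep (proj₁ z′)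
      v′ = rep (proj₂ z′)
      e : u * u + v * v ≈ + i
      e = proj₁ (fibre-sound i k z t)
      f : (u + 1ℤ) * (u + 1ℤ) + v * v ≈ + k
      f = proj₂ (fibre-sound i k z t)
      e′ : u′ * u′ + v′ * v′ ≈ + i
      e′ = proj₁ (fibre-sound i k z′ t′)
      f′ : (u′ + 1ℤ) * (u′ + 1ℤ) + v′ * v′ ≈ + k
      f′ = proj₂ (fibre-sound i k z′ t′)
      lemma₁ : ∀ u v i k → + 2 * u - (k - i - 1ℤ) ≡
        1ℤ * (((u + 1ℤ) * (u + 1ℤ) + v * v) - k) + - 1ℤ * ((u * u + v * v) - i)
      lemma₁ = solve-∀
      lemma₂ : ∀ u v u′ v′ i → v * v - v′ * v′ ≡
        1ℤ * ((u * u + v * v) - i) + - 1ℤ * ((u′ * u′ + v′ * v′) - i) + - (u + u′) * (u - u′)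
      lemma₂ = solve-∀
      2u : + 2 * u ≈ + k - + i - 1ℤ
      2u = combination₂ 1ℤ (- 1ℤ) f e (lemma₁ u v (+ i) (+ k))
      2u′ : + 2 * u′ ≈ + k - + i - 1ℤ
      2u′ = combination₂ 1ℤ (- 1ℤ) f′ e′ (lemma₁ u′ v′ (+ i) (+ k))
      u≈u′ : u ≈ u′
      u≈u′ = *-cancelˡ-≈ (+ 2) 2≉0 (≈-trans 2u (≈-sym 2u′))

  fibre-total : ∀ (i : Fin p) → toℕ i ≢ 0 →
    sumℕ (allFin p) (λ k → count (fibre (toℕ i) (toℕ k)) (pts p)) ≡ suc p
  fibre-total i i≢0 = trans (sumℕ-fibres p (inC p (toℕ i)) translate (λ _ → m%n<n _ p) (pts p)) (cardC-≡ i i≢0)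

  -- The two images together receive 2(p + 1) points, with at most two from either circle in each of the p fibres.
  common-neighbour : ∀ (i j : Fin p) → toℕ i ≢ 0 → toℕ j ≢ 0 →
    ∃[ k ] (suc p ≤ Ncount p (toℕ i) 1 (toℕ k) × suc p ≤ Ncount p (toℕ j) 1 (toℕ k))
  common-neighbour i j i≢0 j≢0 = proj₁ found , reach i (positive (fibre-≤2 (toℕ j) (toℕ k)) (proj₂ found)) ,
    reach j (positive (fibre-≤2 (toℕ i) (toℕ k)) (subst (2 <_) (ℕ.+-comm (n i k) (n j k)) (proj₂ found)))
    where
    n : Fin p → Fin p → ℕ
    n i k = count (fibre (toℕ i) (toℕ k)) (pts p)
    total : sumℕ (allFin p) (λ k → n i k ℕ.+ n j k) ≡ suc p ℕ.+ suc p
    total = trans (sumℕ-+ (allFin p) (n i) (n j)) (cong₂ ℕ._+_ (fibre-total i i≢0) (fibre-total j j≢0))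
    2p< : ∀ m → m ℕ.* 2 < suc m ℕ.+ suc m
    2p< m = ℕ.≤-trans (ℕ.≤-reflexive (cong suc (ℕ-lemma m))) (ℕ.+-monoʳ-≤ (suc m) (ℕ.n≤1+n m))
      where
      ℕ-lemma : ∀ m → m ℕ.* 2 ≡ m ℕ.+ m
      ℕ-lemma = ℕ-solver.solve-∀
    found : ∃[ k ] 2 < n i k ℕ.+ n j k
    found = sumℕ-pigeonhole (allFin p) (λ k → n i k ℕ.+ n j k) 2
      (ℕ.≤-trans (ℕ.≤-reflexive (cong (λ m → suc (m ℕ.* 2)) (length-allFin p)))
        (ℕ.≤-trans (2p< p) (ℕ.≤-reflexive (sym total))))
    k : Fin p
    k = proj₁ found
    positive : ∀ {x y} → y ≤ 2 → 2 < x ℕ.+ y → 0 < x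
    positive {zero} y≤2 lt = ⊥-elim (ℕ.<⇒≱ lt y≤2)
    positive {suc x} _ _ = s≤s z≤n
    reach : ∀ l → 0 < n l k → suc p ≤ Ncount p (toℕ l) 1 (toℕ k)
    reach l pos = Ncount-≥ (toℕ l) (toℕ k) (proj₁ w) (toℕ<n l) (toℕ<n k) (proj₁ e) (proj₂ e)
      where
      w = count-witness (fibre (toℕ l) (toℕ k)) (pts p) pos
      e = fibre-sound (toℕ l) (toℕ k) (proj₁ w) (proj₂ w)

-- Rational arithmetic: finite sums, averages, fractions and the bound e ≤ 3.

ℚ-ring : AlmostCommutativeRing 0ℓ 0ℓ
ℚ-ring = fromCommutativeRing ℚ.+-*-commutativeRing (λ x → dec⇒maybe (0ℚ ℚ.≟ x))

module Rational where
  open import Data.Rational using (_+_; _-_; _*_; -_; _≤_; _/_)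

  open import Data.Integer using () renaming (+_ to pos)

  private variable
    A B : Set

  -- Inequalities are derived from nonnegative combinations of differences.
  ≤⇒0≤- : ∀ {x y} → x ≤ y → 0ℚ ≤ y - x
  ≤⇒0≤- {x} {y} le = subst (_≤ y - x) (ℚ.+-inverseʳ x) (ℚ.+-monoˡ-≤ (- x) le)

  0≤-⇒≤ : ∀ {x y} d → 0ℚ ≤ d → y - x ≡ d → x ≤ y
  0≤-⇒≤ {x} {y} d 0≤d eq = subst (x ≤_) (lemma x y)
    (subst (_≤ x + (y - x)) (ℚ.+-identityʳ x) (ℚ.+-monoʳ-≤ x (subst (0ℚ ≤_) (sym eq) 0≤d)))
    where
    lemma : ∀ x y → x + (y - x) ≡ y
    lemma = RingSolver.solve-∀ ℚ-ring

  0≤-+ : ∀ {x y} → 0ℚ ≤ x → 0ℚ ≤ y → 0ℚ ≤ x + y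
  0≤-+ {x} {y} 0≤x 0≤y = ℚ.+-mono-≤ 0≤x 0≤y

  *-mono-0≤ : ∀ {r x y} → 0ℚ ≤ r → x ≤ y → r * x ≤ r * y
  *-mono-0≤ {r} 0≤r = ℚ.*-monoˡ-≤-nonNeg r {{ℚ.nonNegative 0≤r}}

  0≤-* : ∀ {x y} → 0ℚ ≤ x → 0ℚ ≤ y → 0ℚ ≤ x * y
  0≤-* {x} {y} 0≤x 0≤y = subst (_≤ x * y) (ℚ.*-zeroʳ x) (*-mono-0≤ 0≤x 0≤y)

  sumℚ : List A → (A → ℚ) → ℚ
  sumℚ xs f = foldr (λ x acc → f x + acc) 0ℚ xs

  sumℚ-cong : (xs : List A) {f g : A → ℚ} → (∀ x → f x ≡ g x) → sumℚ xs f ≡ sumℚ xs g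
  sumℚ-cong [] eq = refl
  sumℚ-cong (x ∷ xs) eq = cong₂ _+_ (eq x) (sumℚ-cong xs eq)

  sumℚ-zero : (xs : List A) → sumℚ xs (λ _ → 0ℚ) ≡ 0ℚ
  sumℚ-zero [] = refl
  sumℚ-zero (x ∷ xs) = trans (ℚ.+-identityˡ _) (sumℚ-zero xs)

  sumℚ-+ : (xs : List A) (f g : A → ℚ) → sumℚ xs (λ x → f x + g x) ≡ sumℚ xs f + sumℚ xs g
  sumℚ-+ [] f g = refl
  sumℚ-+ (x ∷ xs) f g = trans (cong (f x + g x +_) (sumℚ-+ xs f g))
    (interchange (f x) (g x) (sumℚ xs f) (sumℚ xs g))
    where
    interchange : ∀ a b c d → a + b + (c + d) ≡ a + c + (b + d)
    interchange = RingSolver.solve-∀ ℚ-ring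

  sumℚ-*ʳ : (xs : List A) (f : A → ℚ) (c : ℚ) → sumℚ xs (λ x → f x * c) ≡ sumℚ xs f * c
  sumℚ-*ʳ [] f c = sym (ℚ.*-zeroˡ c)
  sumℚ-*ʳ (x ∷ xs) f c = trans (cong (f x * c +_) (sumℚ-*ʳ xs f c)) (sym (ℚ.*-distribʳ-+ c (f x) (sumℚ xs f)))

  sumℚ-*ˡ : (xs : List A) (f : A → ℚ) (c : ℚ) → sumℚ xs (λ x → c * f x) ≡ c * sumℚ xs f
  sumℚ-*ˡ xs f c = trans (sumℚ-cong xs (λ x → ℚ.*-comm c (f x))) (trans (sumℚ-*ʳ xs f c) (ℚ.*-comm _ c))

  sumℚ-swap : (xs : List A) (ys : List B) (f : A → B → ℚ) →
    sumℚ xs (λ x → sumℚ ys (f x)) ≡ sumℚ ys (λ y → sumℚ xs (λ x → f x y))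
  sumℚ-swap [] ys f = sym (sumℚ-zero ys)
  sumℚ-swap (x ∷ xs) ys f = trans (cong (sumℚ ys (f x) +_) (sumℚ-swap xs ys f))
    (sym (sumℚ-+ ys (f x) (λ y → sumℚ xs (λ x → f x y))))

  sumℚ-map : (f : A → B) (g : B → ℚ) (xs : List A) → sumℚ (map f xs) g ≡ sumℚ xs (g ∘ f)
  sumℚ-map f g [] = refl
  sumℚ-map f g (x ∷ xs) = cong (g (f x) +_) (sumℚ-map f g xs)

  sumℚ-allFin-suc : ∀ n (f : Fin (suc n) → ℚ) →
    sumℚ (allFin (suc n)) f ≡ f Fin.zero + sumℚ (allFin n) (f ∘ Fin.suc)
  sumℚ-allFin-suc n f = cong (f Fin.zero +_) (trans
    (cong (λ l → sumℚ l f) (sym (map-tabulate (λ i → i) Fin.suc))) (sumℚ-map Fin.suc f (allFin n)))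

  sumℚ-nonPos : (xs : List A) (f : A → ℚ) → (∀ x → f x ≤ 0ℚ) → sumℚ xs f ≤ 0ℚ
  sumℚ-nonPos [] f le = ℚ.≤-refl
  sumℚ-nonPos (x ∷ xs) f le = ℚ.+-mono-≤ (le x) (sumℚ-nonPos xs f le)

  sumℚ-≤-term : ∀ n (f : Fin n → ℚ) (z : Fin n) → (∀ k → k ≢ z → f k ≤ 0ℚ) → sumℚ (allFin n) f ≤ f z
  sumℚ-≤-term (suc n) f Fin.zero le = ℚ.≤-trans (ℚ.≤-reflexive (sumℚ-allFin-suc n f))
    (subst (f Fin.zero + sumℚ (allFin n) (f ∘ Fin.suc) ≤_) (ℚ.+-identityʳ (f Fin.zero))
      (ℚ.+-monoʳ-≤ (f Fin.zero) (sumℚ-nonPos (allFin n) (f ∘ Fin.suc) (λ k → le (Fin.suc k) λ ()))))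
  sumℚ-≤-term (suc n) f (Fin.suc z) le = ℚ.≤-trans (ℚ.≤-reflexive (sumℚ-allFin-suc n f))
    (subst (f Fin.zero + sumℚ (allFin n) (f ∘ Fin.suc) ≤_) (ℚ.+-identityˡ (f (Fin.suc z)))
      (ℚ.+-mono-≤ (le Fin.zero λ ()) (sumℚ-≤-term n (f ∘ Fin.suc) z
        (λ k k≢z → le (Fin.suc k) λ { refl → k≢z refl }))))

  sumℚ-δ : ∀ n (i : Fin n) (g : Fin n → ℚ) → sumℚ (allFin n) (λ j → δ n i j * g j) ≡ g i
  sumℚ-δ (suc n) Fin.zero g = trans (sumℚ-allFin-suc n (λ j → δ (suc n) Fin.zero j * g j))
    (trans (cong₂ _+_ (ℚ.*-identityˡ (g Fin.zero))
        (trans (sumℚ-cong (allFin n) (λ j → ℚ.*-zeroˡ (g (Fin.suc j)))) (sumℚ-zero (allFin n))))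
      (ℚ.+-identityʳ (g Fin.zero)))
  sumℚ-δ (suc n) (Fin.suc i) g = trans (sumℚ-allFin-suc n (λ j → δ (suc n) (Fin.suc i) j * g j))
    (trans (cong₂ _+_ (ℚ.*-zeroˡ (g Fin.zero)) (sumℚ-δ n i (g ∘ Fin.suc))) (ℚ.+-identityˡ _))

  argmax : ∀ n (f : Fin (suc n) → ℚ) → ∃[ i ] (∀ j → f j ≤ f i)
  argmax zero f = Fin.zero , λ { Fin.zero → ℚ.≤-refl }
  argmax (suc n) f with argmax n (f ∘ Fin.suc)
  ... | i , max with ℚ.≤-total (f Fin.zero) (f (Fin.suc i))
  ... | inj₁ le = Fin.suc i , λ { Fin.zero → le ; (Fin.suc j) → max j }
  ... | inj₂ ge = Fin.zero , λ { Fin.zero → ℚ.≤-refl ; (Fin.suc j) → ℚ.≤-trans (max j) ge }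

  neg-cancel-≤ : ∀ {x y} → - x ≤ - y → y ≤ x
  neg-cancel-≤ {x} {y} le = 0≤-⇒≤ (- y - - x) (≤⇒0≤- le) (lemma x y)
    where
    lemma : ∀ x y → x - y ≡ - y - - x
    lemma = RingSolver.solve-∀ ℚ-ring

  argmin : ∀ n (f : Fin (suc n) → ℚ) → ∃[ i ] (∀ j → f i ≤ f j)
  argmin n f with argmax n (λ i → - f i)
  ... | i , max = i , λ j → neg-cancel-≤ (max j)

  -- Recentred at `c`, every term except that of `z` is nonpositive. Keeping the value at `z` exact
  -- serves twice: `z` is the shared state in `act-overlap` and state 0 in `contraction`.
  average-≤ : ∀ n (w g : Fin n → ℚ) c z → (∀ k → 0ℚ ≤ w k) → sumℚ (allFin n) w ≡ 1ℚ →
    (∀ k → k ≢ z → g k ≤ c) → sumℚ (allFin n) (λ k → w k * g k) ≤ c + w z * (g z - c)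
  average-≤ n w g c z 0≤w total le = subst (_≤ c + w z * (g z - c)) recentre
    (ℚ.+-monoʳ-≤ c (sumℚ-≤-term n (λ k → w k * (g k - c)) z (λ k k≢z → neg-cancel-≤
      (subst (0ℚ ≤_) (lemma₁ (w k) (g k) c) (0≤-* (0≤w k) (≤⇒0≤- (le k k≢z)))))))
    where
    lemma₁ : ∀ w g c → w * (c - g) ≡ - (w * (g - c))
    lemma₁ = RingSolver.solve-∀ ℚ-ring
    lemma₂ : ∀ w g c → w * (g - c) ≡ w * g + w * (- c)
    lemma₂ = RingSolver.solve-∀ ℚ-ring
    lemma₃ : ∀ s c → c + (s + 1ℚ * (- c)) ≡ s
    lemma₃ = RingSolver.solve-∀ ℚ-ring
    recentre : c + sumℚ (allFin n) (λ k → w k * (g k - c)) ≡ sumℚ (allFin n) (λ k → w k * g k)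
    recentre = begin
      c + sumℚ (allFin n) (λ k → w k * (g k - c))
        ≡⟨ cong (c +_) (sumℚ-cong (allFin n) (λ k → lemma₂ (w k) (g k) c)) ⟩
      c + sumℚ (allFin n) (λ k → w k * g k + w k * (- c))
        ≡⟨ cong (c +_) (sumℚ-+ (allFin n) (λ k → w k * g k) (λ k → w k * (- c))) ⟩
      c + (sumℚ (allFin n) (λ k → w k * g k) + sumℚ (allFin n) (λ k → w k * (- c)))
        ≡⟨ cong (λ s → c + (sumℚ (allFin n) (λ k → w k * g k) + s))
             (trans (sumℚ-*ʳ (allFin n) w (- c)) (cong (_* (- c)) total)) ⟩
      c + (sumℚ (allFin n) (λ k → w k * g k) + 1ℚ * (- c))
        ≡⟨ lemma₃ _ c ⟩
      sumℚ (allFin n) (λ k → w k * g k) ∎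
      where open ≡-Reasoning

  average-≥ : ∀ n (w g : Fin n → ℚ) c z → (∀ k → 0ℚ ≤ w k) → sumℚ (allFin n) w ≡ 1ℚ →
    (∀ k → k ≢ z → c ≤ g k) → c + w z * (g z - c) ≤ sumℚ (allFin n) (λ k → w k * g k)
  average-≥ n w g c z 0≤w total le = neg-cancel-≤ (subst₂ _≤_ negated (lemma₂ (w z) (g z) c)
    (average-≤ n w (λ k → - g k) (- c) z 0≤w total (λ k k≢z → ℚ.neg-antimono-≤ (le k k≢z))))
    where
    lemma₁ : ∀ w g → w * (- g) ≡ w * g * (- 1ℚ)
    lemma₁ = RingSolver.solve-∀ ℚ-ring
    lemma₂ : ∀ w g c → - c + w * (- g - - c) ≡ - (c + w * (g - c))
    lemma₂ = RingSolver.solve-∀ ℚ-ring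
    lemma₃ : ∀ s → s * (- 1ℚ) ≡ - s
    lemma₃ = RingSolver.solve-∀ ℚ-ring
    negated : sumℚ (allFin n) (λ k → w k * (- g k)) ≡ - sumℚ (allFin n) (λ k → w k * g k)
    negated = trans (sumℚ-cong (allFin n) (λ k → lemma₁ (w k) (g k)))
      (trans (sumℚ-*ʳ (allFin n) (λ k → w k * g k) (- 1ℚ)) (lemma₃ _))

  Within : ∀ {n} → (Fin n → ℚ) → ℚ → ℚ → Set
  Within g a b = ∀ i → a ≤ g i × g i ≤ b

  abstract
    -- `fromℕ` and `inv` are opaque, so that the reduction of fractions to lowest terms is never run
    -- on symbolic numerators and denominators.
    fromℕ : ℕ → ℚ
    fromℕ n = pos n / 1

    inv : ℕ → ℚ
    inv = divq 1

    toℚᵘ-fromℕ : ∀ n → toℚᵘ (fromℕ n) ℚᵘ.≃ mkℚᵘ (pos n) 0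
    toℚᵘ-fromℕ n = ℚ.toℚᵘ-fromℚᵘ (mkℚᵘ (pos n) 0)

    fromℕ-2 : fromℕ 2 ≡ pos 2 / 1
    fromℕ-2 = refl

    fromℕ-0 : fromℕ 0 ≡ 0ℚ
    fromℕ-0 = refl

    fromℕ-1 : fromℕ 1 ≡ 1ℚ
    fromℕ-1 = refl

    fromℕ-+ : ∀ m n → fromℕ (m ℕ.+ n) ≡ fromℕ m + fromℕ n
    fromℕ-+ m n = ℚ.toℚᵘ-injective (ℚᵘ.≃-trans (toℚᵘ-fromℕ (m ℕ.+ n)) (ℚᵘ.≃-sym
      (ℚᵘ.≃-trans (ℚ.toℚᵘ-homo-+ (fromℕ m) (fromℕ n))
        (ℚᵘ.≃-trans (ℚᵘ.+-cong (toℚᵘ-fromℕ m) (toℚᵘ-fromℕ n)) (*≡* (lemma (pos m) (pos n)))))))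
      where
      lemma : ∀ a b → (a ℤ.* pos 1 ℤ.+ b ℤ.* pos 1) ℤ.* pos 1 ≡ (a ℤ.+ b) ℤ.* pos 1
      lemma = ℤ-solver.solve-∀

    fromℕ-* : ∀ m n → fromℕ (m ℕ.* n) ≡ fromℕ m * fromℕ n
    fromℕ-* m n = ℚ.toℚᵘ-injective (ℚᵘ.≃-trans (toℚᵘ-fromℕ (m ℕ.* n)) (ℚᵘ.≃-sym
      (ℚᵘ.≃-trans (ℚ.toℚᵘ-homo-* (fromℕ m) (fromℕ n))
        (ℚᵘ.≃-trans (ℚᵘ.*-cong (toℚᵘ-fromℕ m) (toℚᵘ-fromℕ n))
          (*≡* (cong (ℤ._* pos 1) (sym (ℤ.pos-* m n))))))))

    0≤fromℕ : ∀ n → 0ℚ ≤ fromℕ n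
    0≤fromℕ n = ℚ.nonNegative⁻¹ (fromℕ n) {{ℚ.normalize-nonNeg n 1}}

    0≤inv : ∀ d → 0ℚ ≤ inv d
    0≤inv zero = ℚ.≤-refl
    0≤inv (suc d) = ℚ.nonNegative⁻¹ (inv (suc d)) {{ℚ.normalize-nonNeg 1 (suc d)}}

    inv-≡ : ∀ d → inv d ≡ divq 1 d
    inv-≡ d = refl

    divq-≡ : ∀ n d → divq n d ≡ fromℕ n * inv d
    divq-≡ n zero = sym (ℚ.*-zeroʳ (fromℕ n))
    divq-≡ n (suc d) = ℚ.toℚᵘ-injective (ℚᵘ.≃-trans (ℚ.toℚᵘ-fromℚᵘ (mkℚᵘ (pos n) d)) (ℚᵘ.≃-sym
      (ℚᵘ.≃-trans (ℚ.toℚᵘ-homo-* (fromℕ n) (inv (suc d)))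
        (ℚᵘ.≃-trans (ℚᵘ.*-cong (toℚᵘ-fromℕ n) (ℚ.toℚᵘ-fromℚᵘ (mkℚᵘ (pos 1) d)))
          (*≡* (trans (lemma (pos n) (pos (suc d))) (cong (λ k → pos n ℤ.* pos k) (sym (ℕ.*-identityˡ (suc d))))))))))
      where
      lemma : ∀ a b → a ℤ.* pos 1 ℤ.* b ≡ a ℤ.* b
      lemma = ℤ-solver.solve-∀

    fromℕ*inv : ∀ d .{{_ : NonZero d}} → fromℕ d * inv d ≡ 1ℚ
    fromℕ*inv (suc d) = trans (sym (divq-≡ (suc d) (suc d)))
      (ℚ.toℚᵘ-injective (ℚᵘ.≃-trans (ℚ.toℚᵘ-fromℚᵘ (mkℚᵘ (pos (suc d)) d))
        (*≡* (ℤ.*-comm (pos (suc d)) (pos 1)))))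

  fromℕ-suc : ∀ n → fromℕ (suc n) ≡ 1ℚ + fromℕ n
  fromℕ-suc n = trans (fromℕ-+ 1 n) (cong (_+ fromℕ n) fromℕ-1)

  fromℕ-mono : ∀ {m n} → m ℕ.≤ n → fromℕ m ≤ fromℕ n
  fromℕ-mono {m} {n} m≤n = 0≤-⇒≤ (fromℕ (n ℕ.∸ m)) (0≤fromℕ (n ℕ.∸ m))
    (trans (cong (λ k → fromℕ k - fromℕ m) (sym (ℕ.m+[n∸m]≡n m≤n)))
      (trans (cong (_- fromℕ m) (fromℕ-+ m (n ℕ.∸ m))) (lemma (fromℕ m) (fromℕ (n ℕ.∸ m)))))
    where
    lemma : ∀ a b → a + b - a ≡ b
    lemma = RingSolver.solve-∀ ℚ-ring

  inv-unique : ∀ d .{{_ : NonZero d}} x → fromℕ d * x ≡ 1ℚ → x ≡ inv d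
  inv-unique d x eq = begin
    x                          ≡⟨ ℚ.*-identityʳ x ⟨
    x * 1ℚ                     ≡⟨ cong (x *_) (fromℕ*inv d) ⟨
    x * (fromℕ d * inv d)      ≡⟨ lemma x (fromℕ d) (inv d) ⟩
    fromℕ d * x * inv d        ≡⟨ cong (_* inv d) eq ⟩
    1ℚ * inv d                 ≡⟨ ℚ.*-identityˡ (inv d) ⟩
    inv d                      ∎
    where
    open ≡-Reasoning
    lemma : ∀ x d e → x * (d * e) ≡ d * x * e
    lemma = RingSolver.solve-∀ ℚ-ring

  inv-* : ∀ m n .{{_ : NonZero m}} .{{_ : NonZero n}} → inv (m ℕ.* n) ≡ inv m * inv n
  inv-* m n = sym (inv-unique (m ℕ.* n) {{ℕ.m*n≢0 m n}} (inv m * inv n) (begin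
    fromℕ (m ℕ.* n) * (inv m * inv n)          ≡⟨ cong (_* (inv m * inv n)) (fromℕ-* m n) ⟩
    fromℕ m * fromℕ n * (inv m * inv n)        ≡⟨ lemma (fromℕ m) (fromℕ n) (inv m) (inv n) ⟩
    fromℕ m * inv m * (fromℕ n * inv n)        ≡⟨ cong₂ _*_ (fromℕ*inv m) (fromℕ*inv n) ⟩
    1ℚ                                         ∎))
    where
    open ≡-Reasoning
    lemma : ∀ a b c d → a * b * (c * d) ≡ a * c * (b * d)
    lemma = RingSolver.solve-∀ ℚ-ring

  inv-anti : ∀ m n .{{_ : NonZero m}} .{{_ : NonZero n}} → m ℕ.≤ n → inv n ≤ inv m
  inv-anti m n m≤n = 0≤-⇒≤ _ (0≤-* (0≤-* (0≤inv m) (0≤inv n)) (≤⇒0≤- (fromℕ-mono m≤n))) (begin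
    inv m - inv n                                          ≡⟨ cong₂ _-_ (ℚ.*-identityʳ (inv m)) (ℚ.*-identityʳ (inv n)) ⟨
    inv m * 1ℚ - inv n * 1ℚ                                ≡⟨ cong₂ (λ x y → inv m * x - inv n * y) (fromℕ*inv n) (fromℕ*inv m) ⟨
    inv m * (fromℕ n * inv n) - inv n * (fromℕ m * inv m)  ≡⟨ lemma (inv m) (inv n) (fromℕ m) (fromℕ n) ⟩
    inv m * inv n * (fromℕ n - fromℕ m)                    ∎)
    where
    open ≡-Reasoning
    lemma : ∀ a b c d → a * (d * b) - b * (c * a) ≡ a * b * (d - c)
    lemma = RingSolver.solve-∀ ℚ-ring

  sumℚ-fromℕ : {A : Set} (xs : List A) (f : A → ℕ) → sumℚ xs (λ x → fromℕ (f x)) ≡ fromℕ (sumℕ xs f)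
  sumℚ-fromℕ [] f = sym fromℕ-0
  sumℚ-fromℕ (x ∷ xs) f = trans (cong (λ s → fromℕ (f x) + s) (sumℚ-fromℕ xs f))
    (sym (fromℕ-+ (f x) (sumℕ xs f)))

  inv-1 : inv 1 ≡ fromℕ 1
  inv-1 = sym (inv-unique 1 (fromℕ 1) (trans (cong₂ _*_ fromℕ-1 fromℕ-1) (ℚ.*-identityˡ 1ℚ)))

  -- The slack 1/n! telescopes: it absorbs the tail of the exponential series.
  eSum+1/n!≤3 : ∀ n → eSum n + inv (n !) ≤ fromℕ 3
  eSum+1/n!≤3 zero = ℚ.≤-trans (ℚ.≤-reflexive (trans (cong₂ _+_ (sym fromℕ-1) inv-1) (sym (fromℕ-+ 1 1))))
    (fromℕ-mono {2} {3} (ℕ.s≤s (ℕ.s≤s ℕ.z≤n)))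
  -- Equality holds here, and the case stands apart: from n = 0 to n = 1 the left side rises from 2
  -- to 3, since the telescoping inequality 2/(n + 1)! ≤ 1/n! starts at n = 1.
  eSum+1/n!≤3 (suc zero) = ℚ.≤-reflexive (trans
    (cong₂ _+_ (cong₂ _+_ (sym fromℕ-1) (trans (sym (inv-≡ 1)) inv-1)) inv-1)
    (trans (cong (_+ fromℕ 1) (sym (fromℕ-+ 1 1))) (sym (fromℕ-+ 2 1))))
  eSum+1/n!≤3 (suc (suc n)) = ℚ.≤-trans
    (0≤-⇒≤ _ (0≤-* (≤⇒0≤- (fromℕ-mono {2} {2 ℕ.+ n} (ℕ.s≤s (ℕ.s≤s ℕ.z≤n)))) (0≤inv (suc (suc n) !))) diff)
    (eSum+1/n!≤3 (suc n))
    where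
    instance
      fact≢0 : NonZero (suc n !)
      fact≢0 = ℕ._!≢0 (suc n)
    i = inv (suc (suc n) !)
    next : inv (suc n !) ≡ fromℕ (2 ℕ.+ n) * i
    next = sym (trans (cong (fromℕ (2 ℕ.+ n) *_) (inv-* (2 ℕ.+ n) (suc n !)))
      (trans (sym (ℚ.*-assoc (fromℕ (2 ℕ.+ n)) (inv (2 ℕ.+ n)) (inv (suc n !))))
        (trans (cong (_* inv (suc n !)) (fromℕ*inv (2 ℕ.+ n))) (ℚ.*-identityˡ _))))
    lemma : ∀ e k i → e + k * i - (e + i + i) ≡ (k - (1ℚ + 1ℚ)) * i
    lemma = RingSolver.solve-∀ ℚ-ring
    diff : eSum (suc n) + inv (suc n !) - (eSum (suc (suc n)) + i) ≡ (fromℕ (2 ℕ.+ n) - fromℕ 2) * i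
    diff = trans (cong₂ (λ x y → eSum (suc n) + x - (eSum (suc n) + y + i)) next (sym (inv-≡ (suc (suc n) !))))
      (trans (lemma (eSum (suc n)) (fromℕ (2 ℕ.+ n)) i)
        (cong (λ t → (fromℕ (2 ℕ.+ n) - t) * i) (sym (trans (fromℕ-+ 1 1) (cong₂ _+_ fromℕ-1 fromℕ-1)))))

  eSum≤3 : ∀ n → eSum n ≤ fromℕ 3
  eSum≤3 n = ℚ.≤-trans (0≤-⇒≤ (inv (n !)) (0≤inv (n !)) (lemma (eSum n) (inv (n !)))) (eSum+1/n!≤3 n)
    where
    lemma : ∀ a b → a + b - a ≡ b
    lemma = RingSolver.solve-∀ ℚ-ring

  0≤eSum : ∀ n → 0ℚ ≤ eSum n
  0≤eSum zero = ℚ.≤-trans (0≤fromℕ 1) (ℚ.≤-reflexive fromℕ-1)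
  0≤eSum (suc n) = 0≤-+ (0≤eSum n) (subst (0ℚ ≤_) (inv-≡ (suc n !)) (0≤inv (suc n !)))

open Rational

0≤½ : 0ℚ ℚ.≤ ½
0≤½ = ℚ.nonNegative⁻¹ ½

-- A stochastic matrix acting on functions.

module Chain (n : ℕ) (A : Fin n → Fin n → ℚ)
  (0≤A : ∀ i j → 0ℚ ℚ.≤ A i j) (row-sum : ∀ i → sumℚ (allFin n) (A i) ≡ 1ℚ) where
  open import Data.Rational using (_+_; _-_; _*_; -_; _≤_)

  act : (Fin n → ℚ) → Fin n → ℚ
  act g i = sumℚ (allFin n) (λ k → A i k * g k)

  -- The accumulating form makes `row-dual` a direct induction, as `row` applies its last step
  -- outermost, and lets `iter (suc k ℕ.* 2) g` unfold to `iter (k ℕ.* 2) (act (act g))`.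
  iter : ℕ → (Fin n → ℚ) → Fin n → ℚ
  iter zero    g = g
  iter (suc t) g = iter t (act g)

  act-dual : ∀ (μ g : Fin n → ℚ) →
    sumℚ (allFin n) (λ j → sumℚ (allFin n) (λ i → μ i * A i j) * g j) ≡ sumℚ (allFin n) (λ i → μ i * act g i)
  act-dual μ g = begin
    sumℚ (allFin n) (λ j → sumℚ (allFin n) (λ i → μ i * A i j) * g j)
      ≡⟨ sumℚ-cong (allFin n) (λ j → sym (sumℚ-*ʳ (allFin n) (λ i → μ i * A i j) (g j))) ⟩
    sumℚ (allFin n) (λ j → sumℚ (allFin n) (λ i → μ i * A i j * g j))
      ≡⟨ sumℚ-swap (allFin n) (allFin n) (λ j i → μ i * A i j * g j) ⟩
    sumℚ (allFin n) (λ i → sumℚ (allFin n) (λ j → μ i * A i j * g j))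
      ≡⟨ sumℚ-cong (allFin n) (λ i → trans (sumℚ-cong (allFin n) (λ j → ℚ.*-assoc (μ i) (A i j) (g j)))
           (sumℚ-*ˡ (allFin n) (λ j → A i j * g j) (μ i))) ⟩
    sumℚ (allFin n) (λ i → μ i * act g i) ∎
    where open ≡-Reasoning

  average-within-≤ : ∀ (w g : Fin n → ℚ) b → (∀ k → 0ℚ ≤ w k) → sumℚ (allFin n) w ≡ 1ℚ → Fin n →
    (∀ k → g k ≤ b) → sumℚ (allFin n) (λ k → w k * g k) ≤ b
  average-within-≤ w g b 0≤w total z le = ℚ.≤-trans (average-≤ n w g b z 0≤w total (λ k _ → le k))
    (0≤-⇒≤ (w z * (b - g z)) (0≤-* (0≤w z) (≤⇒0≤- (le z))) (lemma (w z) (g z) b))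
    where
    lemma : ∀ w g b → b - (b + w * (g - b)) ≡ w * (b - g)
    lemma = RingSolver.solve-∀ ℚ-ring

  average-within-≥ : ∀ (w g : Fin n → ℚ) a → (∀ k → 0ℚ ≤ w k) → sumℚ (allFin n) w ≡ 1ℚ → Fin n →
    (∀ k → a ≤ g k) → a ≤ sumℚ (allFin n) (λ k → w k * g k)
  average-within-≥ w g a 0≤w total z le = ℚ.≤-trans
    (0≤-⇒≤ (w z * (g z - a)) (0≤-* (0≤w z) (≤⇒0≤- (le z))) (lemma (w z) (g z) a))
    (average-≥ n w g a z 0≤w total (λ k _ → le k))
    where
    lemma : ∀ w g a → a + w * (g - a) - a ≡ w * (g - a)
    lemma = RingSolver.solve-∀ ℚ-ring

  act-within : ∀ {g a b} → Within g a b → Within (act g) a b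
  act-within {g} {a} {b} gab i =
    average-within-≥ (A i) g a (0≤A i) (row-sum i) i (proj₁ ∘ gab) ,
    average-within-≤ (A i) g b (0≤A i) (row-sum i) i (proj₂ ∘ gab)

  -- Pricing all states except `k` at `b` in row `i` and at `a` in row `j` bounds the difference by
  -- (b - a) - A i k (b - g k) - A j k (g k - a). Lowering both masses to ε makes the unknown value
  -- g k cancel.
  act-overlap : ∀ {g a b} ε i j k → Within g a b → ε ≤ A i k → ε ≤ A j k →
    act g i - act g j ≤ (b - a) - ε * (b - a)
  act-overlap {g} {a} {b} ε i j k gab εi εj = 0≤-⇒≤ _
    (0≤-+ (0≤-+ (≤⇒0≤- upper) (≤⇒0≤- lower))
      (0≤-+ (0≤-* (≤⇒0≤- εi) (≤⇒0≤- (proj₂ (gab k)))) (0≤-* (≤⇒0≤- εj) (≤⇒0≤- (proj₁ (gab k))))))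
    (lemma (act g i) (act g j) (A i k) (A j k) (g k) a b ε)
    where
    upper = average-≤ n (A i) g b k (0≤A i) (row-sum i) (λ l _ → proj₂ (gab l))
    lower = average-≥ n (A j) g a k (0≤A j) (row-sum j) (λ l _ → proj₁ (gab l))
    lemma : ∀ x y u v g a b ε → (b - a - ε * (b - a)) - (x - y) ≡
      (b + u * (g - b) - x) + (y - (a + v * (g - a))) + ((u - ε) * (b - g) + (v - ε) * (g - a))
    lemma = RingSolver.solve-∀ ℚ-ring

-- Two steps of the chain contract the range of a function.

module Contraction (m : ℕ) (A : Fin (2 ℕ.+ m) → Fin (2 ℕ.+ m) → ℚ)
  (0≤A : ∀ i j → 0ℚ ℚ.≤ A i j) (row-sum : ∀ i → sumℚ (allFin (2 ℕ.+ m)) (A i) ≡ 1ℚ)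
  (ε κ : ℚ) (0≤ε : 0ℚ ℚ.≤ ε) (0≤κ : 0ℚ ℚ.≤ κ) (κ½ε≡1 : κ ℚ.* (½ ℚ.* ε) ≡ 1ℚ)
  (meeting : ∀ i j → ∃[ k ] (ε ℚ.≤ A (Fin.suc i) k × ε ℚ.≤ A (Fin.suc j) k))
  (A0≤½ : ∀ i → A i Fin.zero ℚ.≤ ½) where
  open import Data.Rational using (_+_; _-_; _*_; -_; _≤_; ∣_∣)
  open Chain (2 ℕ.+ m) A 0≤A row-sum public

  -- The width shrinks by the factor 1 - ε/2 = 1 - 1/κ, where κ = 2/ε; the claim is multiplied
  -- through by κ to stay free of division.
  contraction : ∀ {g a b} → Within g a b → ∃[ a′ ] ∃[ b′ ] (Within (act (act g)) a′ b′ ×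
    b′ - a′ ≤ b - a × κ * (b′ - a′) ≤ (κ - 1ℚ) * (b - a))
  contraction {g} {a} {b} gab = a′ , b′ , (λ i → lower i , upper i) , narrower , contracted
    where
    h = act g
    hab = act-within gab
    hi = argmax m (h ∘ Fin.suc)
    lo = argmin m (h ∘ Fin.suc)
    M = h (Fin.suc (proj₁ hi))
    L = h (Fin.suc (proj₁ lo))
    -- In the second step the nonzero states contribute values of at most `M`, and state 0, whose
    -- value is at most `b`, has weight at most ½; hence the midpoint of `M` and `b`, and dually
    -- that of `L` and `a`. Then b′ - a′ is the mean of M - L and b - a.
    a′ = L + ½ * (a - L)
    b′ = M + ½ * (b - M)
    spread : M - L ≤ (b - a) - ε * (b - a)
    spread = act-overlap ε (Fin.suc (proj₁ hi)) (Fin.suc (proj₁ lo)) (proj₁ common) gab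
      (proj₁ (proj₂ common)) (proj₂ (proj₂ common))
      where common = meeting (proj₁ hi) (proj₁ lo)
    a≤b : a ≤ b
    a≤b = ℚ.≤-trans (proj₁ (gab Fin.zero)) (proj₂ (gab Fin.zero))
    upper : ∀ i → act h i ≤ b′
    upper i = ℚ.≤-trans (average-≤ (2 ℕ.+ m) (A i) h M Fin.zero (0≤A i) (row-sum i)
        (λ { Fin.zero z≢z → ⊥-elim (z≢z refl) ; (Fin.suc k) _ → proj₂ hi k }))
      (0≤-⇒≤ _ (0≤-+ (0≤-* (0≤A i Fin.zero) (≤⇒0≤- (proj₂ (hab Fin.zero))))
                 (0≤-* (≤⇒0≤- (A0≤½ i)) (≤⇒0≤- (proj₂ (hab (Fin.suc (proj₁ hi)))))))
        (lemma (A i Fin.zero) ½ (h Fin.zero) M b))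
      where
      lemma : ∀ w s h M b → M + s * (b - M) - (M + w * (h - M)) ≡ w * (b - h) + (s - w) * (b - M)
      lemma = RingSolver.solve-∀ ℚ-ring
    lower : ∀ i → a′ ≤ act h i
    lower i = ℚ.≤-trans
      (0≤-⇒≤ _ (0≤-+ (0≤-* (0≤A i Fin.zero) (≤⇒0≤- (proj₁ (hab Fin.zero))))
                 (0≤-* (≤⇒0≤- (A0≤½ i)) (≤⇒0≤- (proj₁ (hab (Fin.suc (proj₁ lo)))))))
        (lemma (A i Fin.zero) ½ (h Fin.zero) L a))
      (average-≥ (2 ℕ.+ m) (A i) h L Fin.zero (0≤A i) (row-sum i)
        (λ { Fin.zero z≢z → ⊥-elim (z≢z refl) ; (Fin.suc k) _ → proj₂ lo k }))
      where
      lemma : ∀ w s h L a → (L + w * (h - L)) - (L + s * (a - L)) ≡ w * (h - a) + (s - w) * (L - a)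
      lemma = RingSolver.solve-∀ ℚ-ring
    shrink : b′ - a′ ≤ (b - a) - ½ * ε * (b - a)
    shrink = 0≤-⇒≤ (½ * ((b - a) - ε * (b - a) - (M - L))) (0≤-* 0≤½ (≤⇒0≤- spread)) (lemma a b L M ε)
      where
      lemma : ∀ a b L M ε → (b - a - ½ * ε * (b - a)) - (M + ½ * (b - M) - (L + ½ * (a - L))) ≡
        ½ * ((b - a) - ε * (b - a) - (M - L))
      lemma = RingSolver.solve-∀ ℚ-ring
    narrower : b′ - a′ ≤ b - a
    narrower = ℚ.≤-trans shrink (0≤-⇒≤ (½ * ε * (b - a)) (0≤-* (0≤-* 0≤½ 0≤ε) (≤⇒0≤- a≤b)) (lemma (b - a) (½ * ε * (b - a))))
      where
      lemma : ∀ x y → x - (x - y) ≡ y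
      lemma = RingSolver.solve-∀ ℚ-ring
    contracted : κ * (b′ - a′) ≤ (κ - 1ℚ) * (b - a)
    contracted = ℚ.≤-trans (*-mono-0≤ 0≤κ shrink) (ℚ.≤-reflexive (trans (lemma κ (½ * ε) (b - a))
      (cong (λ t → (κ - t) * (b - a)) κ½ε≡1)))
      where
      lemma : ∀ κ e w → κ * (w - e * w) ≡ (κ - κ * e) * w
      lemma = RingSolver.solve-∀ ℚ-ring

  -- Carrying along b′ − a′ ≤ b − a turns the factor (1 − 1/κ)ᵏ into the sufficient κ / (κ + k).
  decay : ∀ k {g a b} → Within g a b → ∃[ a′ ] ∃[ b′ ] (Within (iter (k ℕ.* 2) g) a′ b′ ×
    b′ - a′ ≤ b - a × (κ + fromℕ k) * (b′ - a′) ≤ κ * (b - a))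
  decay zero {g} {a} {b} gab = a , b , gab , ℚ.≤-refl ,
    ℚ.≤-reflexive (cong (_* (b - a)) (trans (cong (λ t → κ + t) fromℕ-0) (ℚ.+-identityʳ κ)))
  decay (suc k) {g} {a} {b} gab =
    let a₁ , b₁ , within₁ , narrow₁ , contract = contraction gab
        a₂ , b₂ , within₂ , narrow₂ , bound = decay k within₁
        narrow = ℚ.≤-trans narrow₂ narrow₁
    in a₂ , b₂ , within₂ , narrow ,
      -- With w, w₁, w₂ the successive widths: (κ + k) w₂ ≤ κ w₁ ≤ (κ - 1) w, and one more w₂ ≤ w is
      -- added.
      0≤-⇒≤ _ (0≤-+ (0≤-+ (≤⇒0≤- bound) (≤⇒0≤- contract)) (≤⇒0≤- narrow))
        (trans (cong (λ t → κ * (b - a) - (κ + t) * (b₂ - a₂)) (fromℕ-suc k))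
          (lemma κ (fromℕ k) (b - a) (b₁ - a₁) (b₂ - a₂)))
    where
    lemma : ∀ κ k w w₁ w₂ → κ * w - (κ + (1ℚ + k)) * w₂ ≡
      (κ * w₁ - (κ + k) * w₂) + ((κ - 1ℚ) * w - κ * w₁) + (w - w₂)
    lemma = RingSolver.solve-∀ ℚ-ring

-- The walk on circles: kernel entries, stationarity, total variation.

π-zero : ∀ p (j : Fin p) → toℕ j ≡ 0 → π p j ≡ divq 1 (p ℕ.* p)
π-zero p j eq with toℕ j
π-zero p j refl | .0 = refl

π-nonzero : ∀ p (j : Fin p) → toℕ j ≢ 0 → π p j ≡ divq (suc p) (p ℕ.* p)
π-nonzero p j j≢0 with toℕ j
... | zero  = ⊥-elim (j≢0 refl)
... | suc _ = refl

∣∣-sign : ∀ q → ∃[ s ] (ℚ.- 1ℚ ℚ.≤ s × s ℚ.≤ 1ℚ × ℚ.∣ q ∣ ≡ q ℚ.* s)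
∣∣-sign q = cases (ℚ.∣p∣≡p∨∣p∣≡-p q)
  where
  -1≤1 : ℚ.- 1ℚ ℚ.≤ 1ℚ
  -1≤1 = ℚ.≤-trans (ℚ.nonPositive⁻¹ (ℚ.- 1ℚ)) (ℚ.nonNegative⁻¹ 1ℚ)
  lemma : ∀ q → ℚ.- q ≡ q ℚ.* (ℚ.- 1ℚ)
  lemma = RingSolver.solve-∀ ℚ-ring
  cases : ℚ.∣ q ∣ ≡ q ⊎ ℚ.∣ q ∣ ≡ ℚ.- q → ∃[ s ] (ℚ.- 1ℚ ℚ.≤ s × s ℚ.≤ 1ℚ × ℚ.∣ q ∣ ≡ q ℚ.* s)
  cases (inj₁ eq) = 1ℚ , -1≤1 , ℚ.≤-refl , trans eq (sym (ℚ.*-identityʳ q))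
  cases (inj₂ eq) = ℚ.- 1ℚ , ℚ.≤-refl , -1≤1 , trans eq (lemma q)

module Walk (p : ℕ) .{{nz : NonZero p}} (prime : Prime p) (p%4≡3 : p % 4 ≡ 3) where
  open import Data.Rational using (_+_; _-_; _*_; -_; _≤_; ∣_∣)
  open Circle p prime p%4≡3

  size : Fin p → ℕ
  size i = cardC p (toℕ i)

  N : Fin p → Fin p → ℕ
  N i j = Ncount p (toℕ i) 1 (toℕ j)

  size-nonZero : ∀ i → NonZero (size i)
  size-nonZero i with toℕ i ℕ.≟ 0
  ... | yes i≡0 = subst NonZero (sym (trans (cong (cardC p) i≡0) cardC-0)) _
  ... | no  i≢0 = subst NonZero (sym (cardC-≡ i i≢0)) _

  A₁-≡ : ∀ i j → A₁ p i j ≡ fromℕ (N i j) * (inv (size i) * inv (suc p))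
  A₁-≡ i j = trans (divq-≡ (N i j) (size i ℕ.* cardC p 1)) (cong (fromℕ (N i j) *_)
    (trans (cong (λ c → inv (size i ℕ.* c)) cardC-1) (inv-* (size i) (suc p) {{size-nonZero i}})))

  0≤A₁ : ∀ i j → 0ℚ ≤ A₁ p i j
  0≤A₁ i j = subst (0ℚ ≤_) (sym (A₁-≡ i j))
    (0≤-* (0≤fromℕ (N i j)) (0≤-* (0≤inv (size i)) (0≤inv (suc p))))

  A₁-row-sum : ∀ i → sumℚ (allFin p) (A₁ p i) ≡ 1ℚ
  A₁-row-sum i = begin
    sumℚ (allFin p) (A₁ p i)                                    ≡⟨ sumℚ-cong (allFin p) (A₁-≡ i) ⟩
    sumℚ (allFin p) (λ j → fromℕ (N i j) * c)                   ≡⟨ sumℚ-*ʳ (allFin p) (fromℕ ∘ N i) c ⟩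
    sumℚ (allFin p) (fromℕ ∘ N i) * c                           ≡⟨ cong (_* c) (sumℚ-fromℕ (allFin p) (N i)) ⟩
    fromℕ (sumℕ (allFin p) (N i)) * c
      ≡⟨ cong (λ k → fromℕ k * c) (trans (Ncount-row (toℕ i)) (cong (size i ℕ.*_) cardC-1)) ⟩
    fromℕ (size i ℕ.* suc p) * c                                ≡⟨ cong (_* c) (fromℕ-* (size i) (suc p)) ⟩
    fromℕ (size i) * fromℕ (suc p) * (inv (size i) * inv (suc p))
      ≡⟨ lemma (fromℕ (size i)) (fromℕ (suc p)) (inv (size i)) (inv (suc p)) ⟩
    fromℕ (size i) * inv (size i) * (fromℕ (suc p) * inv (suc p))
      ≡⟨ cong₂ _*_ (fromℕ*inv (size i) {{size-nonZero i}}) (fromℕ*inv (suc p)) ⟩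
    1ℚ ∎
    where
    open ≡-Reasoning
    c = inv (size i) * inv (suc p)
    lemma : ∀ a b c d → a * b * (c * d) ≡ a * c * (b * d)
    lemma = RingSolver.solve-∀ ℚ-ring

  -- For i ≠ 0 there are (p + 1)² pairs in C_i × C₁, and at least p + 1 of them lead to `k`.
  A₁-≥ : ∀ i k → toℕ i ≢ 0 → suc p ℕ.≤ N i k → inv (suc p) ≤ A₁ p i k
  A₁-≥ i k i≢0 le = subst (inv (suc p) ≤_)
    (sym (trans (A₁-≡ i k) (cong (λ c → fromℕ (N i k) * (inv c * inv (suc p))) (cardC-≡ i i≢0))))
    (0≤-⇒≤ _ (0≤-* (≤⇒0≤- (fromℕ-mono le)) (0≤-* (0≤inv (suc p)) (0≤inv (suc p))))
      (trans (cong (λ t → fromℕ (N i k) * (ι * ι) - t) (trans (sym (ℚ.*-identityˡ ι)) (cong (_* ι) (sym (fromℕ*inv (suc p))))))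
        (lemma (fromℕ (N i k)) (fromℕ (suc p)) ι)))
    where
    ι = inv (suc p)
    lemma : ∀ n q ι → n * (ι * ι) - q * ι * ι ≡ (n - q) * (ι * ι)
    lemma = RingSolver.solve-∀ ℚ-ring

  A₁-meeting : ∀ i j → toℕ i ≢ 0 → toℕ j ≢ 0 → ∃[ k ] (inv (suc p) ≤ A₁ p i k × inv (suc p) ≤ A₁ p j k)
  A₁-meeting i j i≢0 j≢0 = let k , le , le′ = common-neighbour i j i≢0 j≢0 in
    k , A₁-≥ i k i≢0 le , A₁-≥ j k j≢0 le′

  inv-2 : inv 2 ≡ ½
  inv-2 = inv-≡ 2

  -- At most |C_i| of the |C_i| (p + 1) pairs have sum zero, so the mass is at most 1/(p + 1), which
  -- is below ½.
  A₁-zero-≤½ : ∀ i z → toℕ z ≡ 0 → A₁ p i z ≤ ½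
  A₁-zero-≤½ i z z≡0 = ℚ.≤-trans
    (0≤-⇒≤ _ (0≤-* (≤⇒0≤- (fromℕ-mono N≤)) (0≤-* (0≤inv (size i)) (0≤inv (suc p)))) diff)
    (ℚ.≤-trans (inv-anti 2 (suc p) (ℕ.m≤n⇒m≤1+n 1<p)) (ℚ.≤-reflexive inv-2))
    where
    N≤ : N i z ℕ.≤ size i
    N≤ = subst (λ k → Ncount p (toℕ i) 1 k ℕ.≤ size i) (sym z≡0) (Ncount-zero-≤ (toℕ i))
    lemma : ∀ s n c ι → s * c * ι - n * (c * ι) ≡ (s - n) * (c * ι)
    lemma = RingSolver.solve-∀ ℚ-ring
    diff : inv (suc p) - A₁ p i z ≡ (fromℕ (size i) - fromℕ (N i z)) * (inv (size i) * inv (suc p))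
    diff = trans (cong₂ _-_ (trans (sym (ℚ.*-identityˡ (inv (suc p))))
        (cong (_* inv (suc p)) (sym (fromℕ*inv (size i) {{size-nonZero i}})))) (A₁-≡ i z))
      (lemma (fromℕ (size i)) (fromℕ (N i z)) (inv (size i)) (inv (suc p)))

  -- `π` is the law of the quadrance of a uniform point of the plane.
  π-≡ : ∀ j → π p j ≡ fromℕ (size j) * inv (p ℕ.* p)
  π-≡ j = trans (go (toℕ j ℕ.≟ 0)) (divq-≡ (size j) (p ℕ.* p))
    where
    go : Dec (toℕ j ≡ 0) → π p j ≡ divq (size j) (p ℕ.* p)
    go (yes j≡0) = trans (π-zero p j j≡0) (cong (λ c → divq c (p ℕ.* p)) (sym (trans (cong (cardC p) j≡0) cardC-0)))
    go (no  j≢0) = trans (π-nonzero p j j≢0) (cong (λ c → divq c (p ℕ.* p)) (sym (cardC-≡ j j≢0)))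

  0≤π : ∀ j → 0ℚ ≤ π p j
  0≤π j = subst (0ℚ ≤_) (sym (π-≡ j)) (0≤-* (0≤fromℕ (size j)) (0≤inv (p ℕ.* p)))

  π-sum : sumℚ (allFin p) (π p) ≡ 1ℚ
  π-sum = begin
    sumℚ (allFin p) (π p)                                       ≡⟨ sumℚ-cong (allFin p) π-≡ ⟩
    sumℚ (allFin p) (λ j → fromℕ (size j) * inv (p ℕ.* p))      ≡⟨ sumℚ-*ʳ (allFin p) (fromℕ ∘ size) (inv (p ℕ.* p)) ⟩
    sumℚ (allFin p) (fromℕ ∘ size) * inv (p ℕ.* p)
      ≡⟨ cong (_* inv (p ℕ.* p)) (trans (sumℚ-fromℕ (allFin p) size) (cong fromℕ cardC-total)) ⟩
    fromℕ (p ℕ.* p) * inv (p ℕ.* p)                             ≡⟨ fromℕ*inv (p ℕ.* p) {{ℕ.m*n≢0 p p}} ⟩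
    1ℚ ∎
    where open ≡-Reasoning

  -- In `π p i * A₁ p i j` the size |C_i| cancels and N_ij / (p² (p + 1)) remains; the column sum (p
  -- + 1) |C_j| then gives |C_j| / p².
  π-stationary : ∀ j → sumℚ (allFin p) (λ i → π p i * A₁ p i j) ≡ π p j
  π-stationary j = begin
    sumℚ (allFin p) (λ i → π p i * A₁ p i j)                    ≡⟨ sumℚ-cong (allFin p) flow ⟩
    sumℚ (allFin p) (λ i → fromℕ (N i j) * c)                   ≡⟨ sumℚ-*ʳ (allFin p) (λ i → fromℕ (N i j)) c ⟩
    sumℚ (allFin p) (λ i → fromℕ (N i j)) * c                   ≡⟨ cong (_* c) (sumℚ-fromℕ (allFin p) (λ i → N i j)) ⟩
    fromℕ (sumℕ (allFin p) (λ i → N i j)) * c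
      ≡⟨ cong (λ k → fromℕ k * c) (trans (Ncount-column j) (cong (ℕ._* size j) cardC-1)) ⟩
    fromℕ (suc p ℕ.* size j) * c                                ≡⟨ cong (_* c) (fromℕ-* (suc p) (size j)) ⟩
    fromℕ (suc p) * fromℕ (size j) * c
      ≡⟨ lemma₂ (fromℕ (suc p)) (fromℕ (size j)) (inv (p ℕ.* p)) (inv (suc p)) ⟩
    fromℕ (suc p) * inv (suc p) * (fromℕ (size j) * inv (p ℕ.* p))
      ≡⟨ trans (cong (_* (fromℕ (size j) * inv (p ℕ.* p))) (fromℕ*inv (suc p))) (ℚ.*-identityˡ _) ⟩
    fromℕ (size j) * inv (p ℕ.* p)                              ≡⟨ π-≡ j ⟨
    π p j ∎
    where
    open ≡-Reasoning
    c = inv (p ℕ.* p) * inv (suc p)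
    lemma₁ : ∀ s q n t ι → s * q * (n * (t * ι)) ≡ s * t * (n * (q * ι))
    lemma₁ = RingSolver.solve-∀ ℚ-ring
    lemma₂ : ∀ k s q ι → k * s * (q * ι) ≡ k * ι * (s * q)
    lemma₂ = RingSolver.solve-∀ ℚ-ring
    flow : ∀ i → π p i * A₁ p i j ≡ fromℕ (N i j) * c
    flow i = trans (cong₂ _*_ (π-≡ i) (A₁-≡ i j))
      (trans (lemma₁ (fromℕ (size i)) (inv (p ℕ.* p)) (fromℕ (N i j)) (inv (size i)) (inv (suc p)))
        (trans (cong (_* (fromℕ (N i j) * c)) (fromℕ*inv (size i) {{size-nonZero i}})) (ℚ.*-identityˡ _)))

  open Chain p (A₁ p) 0≤A₁ A₁-row-sum

  row-dual : ∀ t i g → sumℚ (allFin p) (λ j → row p t i j * g j) ≡ iter t g i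
  row-dual zero    i g = sumℚ-δ p i g
  row-dual (suc t) i g = trans (act-dual (row p t i) g) (row-dual t i (act g))

  π-dual : ∀ t g → sumℚ (allFin p) (λ j → π p j * g j) ≡ sumℚ (allFin p) (λ j → π p j * iter t g j)
  π-dual zero    g = refl
  π-dual (suc t) g = trans (sumℚ-cong (allFin p) (λ j → cong (_* g j) (sym (π-stationary j))))
    (trans (act-dual (π p) g) (π-dual t (act g)))

  -- The total variation distance is attained by testing against a function with values ±1.
  distance-≤ : ∀ t i W → (∀ g → Within g (- 1ℚ) 1ℚ → ∃[ a ] ∃[ b ] (Within (iter t g) a b × b - a ≤ W)) →
    sumℚ (allFin p) (λ x → ∣ row p t i x - π p x ∣) ≤ W
  distance-≤ t i W bounds = ℚ.≤-trans (ℚ.≤-reflexive tested) (ℚ.≤-trans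
    -- Both the value of `iter t s` at `i` and its `π`-average lie in [a, b], so they differ by at
    -- most b - a.
    (0≤-⇒≤ _ (0≤-+ (≤⇒0≤- (proj₂ (within i)))
        (≤⇒0≤- (average-within-≥ (π p) (iter t s) a 0≤π π-sum i (proj₁ ∘ within))))
      (lemma₂ (iter t s i) (sumℚ (allFin p) (λ x → π p x * iter t s x)) a b))
    narrow)
    where
    d : Fin p → ℚ
    d x = row p t i x - π p x
    s : Fin p → ℚ
    s x = proj₁ (∣∣-sign (d x))
    found = bounds s (λ x → proj₁ (proj₂ (∣∣-sign (d x))) , proj₁ (proj₂ (proj₂ (∣∣-sign (d x)))))
    a = proj₁ found
    b = proj₁ (proj₂ found)
    within = proj₁ (proj₂ (proj₂ found))
    narrow = proj₂ (proj₂ (proj₂ found))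
    lemma₁ : ∀ r q s → (r - q) * s ≡ r * s + q * s * (- 1ℚ)
    lemma₁ = RingSolver.solve-∀ ℚ-ring
    lemma₂ : ∀ x y a b → b - a - (x - y) ≡ (b - x) + (y - a)
    lemma₂ = RingSolver.solve-∀ ℚ-ring
    lemma₃ : ∀ x y → x + y * (- 1ℚ) ≡ x - y
    lemma₃ = RingSolver.solve-∀ ℚ-ring
    tested : sumℚ (allFin p) (λ x → ∣ d x ∣) ≡ iter t s i - sumℚ (allFin p) (λ x → π p x * iter t s x)
    tested = begin
      sumℚ (allFin p) (λ x → ∣ d x ∣)
        ≡⟨ sumℚ-cong (allFin p) (λ x → trans (proj₂ (proj₂ (proj₂ (∣∣-sign (d x))))) (lemma₁ (row p t i x) (π p x) (s x))) ⟩
      sumℚ (allFin p) (λ x → row p t i x * s x + π p x * s x * (- 1ℚ))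
        ≡⟨ sumℚ-+ (allFin p) (λ x → row p t i x * s x) (λ x → π p x * s x * (- 1ℚ)) ⟩
      sumℚ (allFin p) (λ x → row p t i x * s x) + sumℚ (allFin p) (λ x → π p x * s x * (- 1ℚ))
        ≡⟨ cong₂ _+_ (row-dual t i s) (trans (sumℚ-*ʳ (allFin p) (λ x → π p x * s x) (- 1ℚ)) (cong (_* (- 1ℚ)) (π-dual t s))) ⟩
      iter t s i + sumℚ (allFin p) (λ x → π p x * iter t s x) * (- 1ℚ)
        ≡⟨ lemma₃ (iter t s i) (sumℚ (allFin p) (λ x → π p x * iter t s x)) ⟩
      iter t s i - sumℚ (allFin p) (λ x → π p x * iter t s x) ∎
      where open ≡-Reasoning

  -- The factor 2 in `≤1/2e` cancels the ½ of `dTV`, so the sum of absolute differences times e must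
  -- not exceed 1; as e ≤ 3, a sum of at most 1/3 is enough.
  mixed-from-distance : ∀ t i → sumℚ (allFin p) (λ x → ∣ row p t i x - π p x ∣) ≤ inv 3 → mixedAt p t i
  mixed-from-distance t i le n = ℚ.≤-trans (ℚ.≤-reflexive (cong (_* eSum n) halves))
    (0≤-⇒≤ _ (0≤-+ (0≤-* (0≤eSum n) (≤⇒0≤- le)) (0≤-* (0≤inv 3) (≤⇒0≤- (eSum≤3 n))))
      (trans (cong (_- S * eSum n) (sym (fromℕ*inv 3))) (lemma₂ (fromℕ 3) (inv 3) S (eSum n))))
    where
    S = sumℚ (allFin p) (λ x → ∣ row p t i x - π p x ∣)
    halves : (ℤ.+ 2 ℚ./ 1) * (½ * S) ≡ S
    halves = trans (sym (ℚ.*-assoc (ℤ.+ 2 ℚ./ 1) ½ S)) (ℚ.*-identityˡ S)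
    lemma₂ : ∀ t τ S e → t * τ - S * e ≡ e * (τ - S) + τ * (t - e)
    lemma₂ = RingSolver.solve-∀ ℚ-ring

-- Number of rounds and the final constant.

module Mixing (m : ℕ) (prime : Prime (2 ℕ.+ m)) (p%4≡3 : (2 ℕ.+ m) % 4 ≡ 3) where
  open import Data.Rational using (_+_; _-_; _*_; -_; _≤_)
  p = 2 ℕ.+ m
  open Walk p prime p%4≡3

  κ = fromℕ (2 ℕ.* suc p)

  κ½ε≡1 : κ * (½ * inv (suc p)) ≡ 1ℚ
  κ½ε≡1 = trans (cong (λ h → κ * (h * inv (suc p))) (sym inv-2))
    (trans (cong (κ *_) (sym (inv-* 2 (suc p)))) (fromℕ*inv (2 ℕ.* suc p)))

  open Contraction m (A₁ p) 0≤A₁ A₁-row-sum (inv (suc p)) κ (0≤inv (suc p)) (0≤fromℕ (2 ℕ.* suc p)) κ½ε≡1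
    (λ i j → A₁-meeting (Fin.suc i) (Fin.suc j) (λ ()) (λ ())) (λ i → A₁-zero-≤½ i Fin.zero refl)

  -- The number of rounds is kept as a variable, since row and iter compute by recursion on the time.
  module Rounds (k : ℕ) (k≡ : k ≡ 5 ℕ.* (2 ℕ.* suc p)) where
    -- The width has to drop from 2 to 1/3, a factor of 6, and κ / (κ + k) = 1/6 exactly when k =
    -- 5κ, with κ = 2(p + 1).
    narrow : ∀ g → Within g (- 1ℚ) 1ℚ → ∃[ a ] ∃[ b ] (Within (iter (k ℕ.* 2) g) a b × b - a ≤ inv 3)
    narrow g within = let a , b , within′ , _ , bound = decay k within in a , b , within′ ,
      0≤-⇒≤ _ (0≤-* (0≤-* (0≤inv 6) (0≤inv (2 ℕ.* suc p))) (≤⇒0≤- bound)) (diff (b - a))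
      where
      μ = inv (2 ℕ.* suc p)
      two : 1ℚ - - 1ℚ ≡ fromℕ 2
      two = sym fromℕ-2
      third : inv 6 * fromℕ 2 ≡ inv 3
      third = inv-unique 3 (inv 6 * fromℕ 2) (trans (lemma (fromℕ 3) (inv 6) (fromℕ 2))
        (trans (cong (_* inv 6) (sym (fromℕ-* 3 2))) (fromℕ*inv 6)))
        where
        lemma : ∀ a b c → a * (b * c) ≡ a * c * b
        lemma = RingSolver.solve-∀ ℚ-ring
      diff : ∀ w → inv 3 - w ≡ inv 6 * μ * (κ * (1ℚ - - 1ℚ) - (κ + fromℕ k) * w)
      diff w = sym (begin
        inv 6 * μ * (κ * (1ℚ - - 1ℚ) - (κ + fromℕ k) * w)
          ≡⟨ cong₂ (λ x y → inv 6 * μ * (κ * x - y * w)) two six ⟩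
        inv 6 * μ * (κ * fromℕ 2 - fromℕ 6 * κ * w)
          ≡⟨ lemma (inv 6) μ κ (fromℕ 2) (fromℕ 6) w ⟩
        κ * μ * (inv 6 * fromℕ 2 - fromℕ 6 * inv 6 * w)
          ≡⟨ cong₂ (λ x y → x * (inv 6 * fromℕ 2 - y * w)) (fromℕ*inv (2 ℕ.* suc p)) (fromℕ*inv 6) ⟩
        1ℚ * (inv 6 * fromℕ 2 - 1ℚ * w)
          ≡⟨ ℚ.*-identityˡ _ ⟩
        inv 6 * fromℕ 2 - 1ℚ * w
          ≡⟨ cong₂ _-_ third (ℚ.*-identityˡ w) ⟩
        inv 3 - w ∎)
        where
        open ≡-Reasoning
        lemma : ∀ s μ κ t u w → s * μ * (κ * t - u * κ * w) ≡ κ * μ * (s * t - u * s * w)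
        lemma = RingSolver.solve-∀ ℚ-ring
        six : κ + fromℕ k ≡ fromℕ 6 * κ
        six = trans (trans (cong (λ n → κ + fromℕ n) k≡) (sym (fromℕ-+ (2 ℕ.* suc p) (5 ℕ.* (2 ℕ.* suc p))))) (fromℕ-* 6 (2 ℕ.* suc p))

    mixed : ∀ i → mixedAt p (k ℕ.* 2) i
    mixed i = mixed-from-distance (k ℕ.* 2) i (distance-≤ (k ℕ.* 2) i (inv 3) narrow)

-- Two steps in each of the 10(n + 1) rounds make 20n + 20 steps; doubling the coefficient of n
-- absorbs the summand 20.
20[n+1]≤40n : ∀ n k → 1 ℕ.≤ n → k ≡ 5 ℕ.* (2 ℕ.* suc n) → k ℕ.* 2 ℕ.≤ 40 ℕ.* n
20[n+1]≤40n n k 1≤n refl = ℕ.≤-trans (ℕ.≤-reflexive (lemma₁ n))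
  (ℕ.≤-trans (ℕ.+-monoʳ-≤ (20 ℕ.* n) (ℕ.*-monoʳ-≤ 20 1≤n)) (ℕ.≤-reflexive (lemma₂ n)))
  where
  lemma₁ : ∀ n → 5 ℕ.* (2 ℕ.* (1 ℕ.+ n)) ℕ.* 2 ≡ 20 ℕ.* n ℕ.+ 20 ℕ.* 1
  lemma₁ = ℕ-solver.solve-∀
  lemma₂ : ∀ n → 20 ℕ.* n ℕ.+ 20 ℕ.* n ≡ 40 ℕ.* n
  lemma₂ = ℕ-solver.solve-∀

open import Data.Nat using (_*_; _≤_)

theorem8 : ∃[ C ] ∃[ N ] ((p : ℕ) → .{{_ : NonZero p}} → Prime p → p % 4 ≡ 3 → N ≤ p
    → (i : Fin p) → ∃[ t ] (t ≤ C * p × mixedAt p t i))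
theorem8 = 40 , 0 , mixing
  where
  mixing-after : ∀ m (pr : Prime (2 ℕ.+ m)) → (2 ℕ.+ m) % 4 ≡ 3 → ∀ i k → k ≡ 5 * (2 * suc (2 ℕ.+ m)) →
    ∃[ t ] (t ≤ 40 * (2 ℕ.+ m) × mixedAt (2 ℕ.+ m) t i)
  mixing-after m pr p%4≡3 i k k≡ = k * 2 , 20[n+1]≤40n (2 ℕ.+ m) k (ℕ.s≤s ℕ.z≤n) k≡ ,
    Mixing.Rounds.mixed m pr p%4≡3 k k≡ i
  mixing : (p : ℕ) → .{{_ : NonZero p}} → Prime p → p % 4 ≡ 3 → 0 ≤ p
    → (i : Fin p) → ∃[ t ] (t ≤ 40 * p × mixedAt p t i)
  mixing zero pr ()
  mixing (suc zero) pr ()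
  mixing (suc (suc m)) pr p%4≡3 _ i = mixing-after m pr p%4≡3 i (5 * (2 * suc (2 ℕ.+ m))) refl
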